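{- For every $\alpha\in\mathbb{R}\setminus\mathbb{Q}(\mathbf{H}_4)$, $$K(\alpha)\le K(1)=\frac{\sqrt2+1}{2}.$$
   Context: The Hecke group $\mathbf{H}_4$ is the subgroup of $\mathrm{PSL}_2(\mathbb{R})$ generated by $\begin{pmatrix}1&\sqrt2\\0&1\end{pmatrix}$ and $\begin{pmatrix}0&-1\\1&0\end{pmatrix}$. The set $\mathbb{Q}(\mathbf{H}_4)\subset \mathbb{R}\cup\{\infty\}$ is the set of all $p/q$ such that $\begin{pmatrix} p & r \\ q & s \end{pmatrix}\in\mathbf{H}_4$ for some $r,s$; its finite elements form the set $\sqrt2\,\mathbb{Q}$. Writing $p/q\in\mathbb{Q}(\mathbf{H}_4)$ always means the normalized form: $(p,q)$ is the first column of a matrix in $\mathbf{H}_4$ with $q>0$. Explicitly, either $p=a$, $q=\sqrt2\,c$ with $a,c\in\mathbb{Z}$, $c>0$, $\gcd(a,2c)=1$, or $p=\sqrt2\,a$, $q=c$ with $a,c\in\mathbb{Z}$, $c>0$, $\gcd(2a,c)=1$. For a real number $\alpha$, $K(\alpha)$ is the infimum of those $K>0$ such that for all sufficiently large real $N$ there is $p/q\in\mathbb{Q}(\mathbf{H}_4)$ with $|q\alpha-p|<\frac{K}{N}$ and $1\le q\le N$. -}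

module Defs where

open import Data.Integer as ℤ using (+_; -[1+_])
import Data.Integer.Properties as ℤ
open import Data.Nat as ℕ using (ℕ; zero; suc)
import Data.Nat.Properties as ℕ
open import Data.Product using (Σ; ∃; ∃-syntax; _×_; _,_; proj₁; proj₂)
open import Data.Rational as ℚ using (ℚ; 0ℚ; 1ℚ; ½; mkℚ; positive; nonNegative)
import Data.Rational.Properties as ℚ
open import Data.Rational.Unnormalised as ℚᵘ using (mkℚᵘ)
import Data.Rational.Unnormalised.Properties as ℚᵘ
open import Data.Rational.Solver using (module +-*-Solver)
open import Data.Sum using (_⊎_; inj₁; inj₂)
open import Relation.Binary.PropositionalEquality
  using (_≡_; refl; sym; trans; cong; cong₂; subst; subst₂)
open import Relation.Nullary using (¬_; yes; no; contradiction)

open +-*-Solver using (solve; _:=_; _:+_; _:*_; :-_; con)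

open ℚ.≤-Reasoning

module ℚ-Facts where

  0≤-diff : ∀ {p q} → p ℚ.≤ q → 0ℚ ℚ.≤ q ℚ.- p
  0≤-diff {p} {q} p≤q =
    subst (ℚ._≤ q ℚ.- p) (ℚ.+-inverseʳ p) (ℚ.+-monoˡ-≤ (ℚ.- p) p≤q)

  diff-≤ : ∀ {p q} → 0ℚ ℚ.≤ q ℚ.- p → p ℚ.≤ q
  diff-≤ {p} {q} h = subst₂ ℚ._≤_ (ℚ.+-identityˡ p)
    (solve 2 (λ p q → (q :+ (:- p)) :+ p := q) refl p q) (ℚ.+-monoˡ-≤ p h)

  +-0≤ : ∀ {p q} → 0ℚ ℚ.≤ p → 0ℚ ℚ.≤ q → 0ℚ ℚ.≤ p ℚ.+ q
  +-0≤ = ℚ.+-mono-≤ {0ℚ} {_} {0ℚ}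

  *-0≤ : ∀ {p q} → 0ℚ ℚ.≤ p → 0ℚ ℚ.≤ q → 0ℚ ℚ.≤ p ℚ.* q
  *-0≤ {p} {q} hp hq = subst (ℚ._≤ p ℚ.* q) (ℚ.*-zeroˡ q)
    (ℚ.*-monoʳ-≤-nonNeg q {{nonNegative hq}} hp)

  *-0< : ∀ {p q} → 0ℚ ℚ.< p → 0ℚ ℚ.< q → 0ℚ ℚ.< p ℚ.* q
  *-0< {p} {q} hp hq = subst (ℚ._< p ℚ.* q) (ℚ.*-zeroˡ q)
    (ℚ.*-monoˡ-<-pos q {{positive hq}} hp)

  *-mono : ∀ {p q r s} → 0ℚ ℚ.≤ r → 0ℚ ℚ.≤ q → p ℚ.≤ q → r ℚ.≤ s →
           p ℚ.* r ℚ.≤ q ℚ.* s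
  *-mono {p} {q} {r} {s} hr hq p≤q r≤s = ℚ.≤-trans
    (ℚ.*-monoʳ-≤-nonNeg r {{nonNegative hr}} p≤q)
    (ℚ.*-monoˡ-≤-nonNeg q {{nonNegative hq}} r≤s)

  0<½ : 0ℚ ℚ.< ½
  0<½ = ℚ.positive⁻¹ ½

  0<1 : 0ℚ ℚ.< 1ℚ
  0<1 = ℚ.positive⁻¹ 1ℚ

  half-pos : ∀ {ε} → 0ℚ ℚ.< ε → 0ℚ ℚ.< ½ ℚ.* ε
  half-pos = *-0< 0<½

  half+half : ∀ ε → ½ ℚ.* ε ℚ.+ ½ ℚ.* ε ≡ ε
  half+half ε = solve 1 (λ e → con ½ :* e :+ con ½ :* e := e) refl ε

  p≤∣p∣ : ∀ p → p ℚ.≤ ℚ.∣ p ∣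
  p≤∣p∣ p with ℚ.≤-total 0ℚ p
  ... | inj₁ 0≤p = ℚ.≤-reflexive (sym (ℚ.0≤p⇒∣p∣≡p 0≤p))
  ... | inj₂ p≤0 = ℚ.≤-trans p≤0 (ℚ.0≤∣p∣ p)

  ∣∣-≤ : ∀ {p δ} → p ℚ.≤ δ → ℚ.- p ℚ.≤ δ → ℚ.∣ p ∣ ℚ.≤ δ
  ∣∣-≤ {p} h₁ h₂ with ℚ.∣p∣≡p∨∣p∣≡-p p
  ... | inj₁ e = subst (ℚ._≤ _) (sym e) h₁
  ... | inj₂ e = subst (ℚ._≤ _) (sym e) h₂

  ∣p∣≤∣q∣+∣p-q∣ : ∀ p q → ℚ.∣ p ∣ ℚ.≤ ℚ.∣ q ∣ ℚ.+ ℚ.∣ p ℚ.- q ∣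
  ∣p∣≤∣q∣+∣p-q∣ p q = begin
    ℚ.∣ p ∣                    ≡⟨ cong ℚ.∣_∣ (solve 2 (λ p q → p := q :+ (p :+ (:- q))) refl p q) ⟩
    ℚ.∣ q ℚ.+ (p ℚ.- q) ∣      ≤⟨ ℚ.∣p+q∣≤∣p∣+∣q∣ q (p ℚ.- q) ⟩
    ℚ.∣ q ∣ ℚ.+ ℚ.∣ p ℚ.- q ∣  ∎

  ∣p-q∣≡∣q-p∣ : ∀ p q → ℚ.∣ p ℚ.- q ∣ ≡ ℚ.∣ q ℚ.- p ∣
  ∣p-q∣≡∣q-p∣ p q = trans (sym (ℚ.∣-p∣≡∣p∣ (p ℚ.- q)))
    (cong ℚ.∣_∣ (solve 2 (λ p q → :- (p :+ (:- q)) := q :+ (:- p)) refl p q))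

  ∣∣p∣-∣q∣∣≤∣p-q∣ : ∀ p q → ℚ.∣ ℚ.∣ p ∣ ℚ.- ℚ.∣ q ∣ ∣ ℚ.≤ ℚ.∣ p ℚ.- q ∣
  ∣∣p∣-∣q∣∣≤∣p-q∣ p q = ∣∣-≤
    (diff-≤ (subst (0ℚ ℚ.≤_)
      (solve 3 (λ a b c → (b :+ c) :+ (:- a) := c :+ (:- (a :+ (:- b)))) refl
        ℚ.∣ p ∣ ℚ.∣ q ∣ ℚ.∣ p ℚ.- q ∣)
      (0≤-diff (∣p∣≤∣q∣+∣p-q∣ p q))))
    (diff-≤ (subst (0ℚ ℚ.≤_)
      (solve 3 (λ a b c → (a :+ c) :+ (:- b) := c :+ (:- (:- (a :+ (:- b))))) refl
        ℚ.∣ p ∣ ℚ.∣ q ∣ ℚ.∣ p ℚ.- q ∣)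
      (0≤-diff (ℚ.≤-trans (∣p∣≤∣q∣+∣p-q∣ q p)
        (ℚ.≤-reflexive (cong (ℚ.∣ p ∣ ℚ.+_) (∣p-q∣≡∣q-p∣ q p)))))))

open ℚ-Facts

-- Totalised with recip 0 = 0; only its values away from 0 matter below.
recip : ℚ → ℚ
recip p with p ℚ.≟ 0ℚ
... | yes _  = 0ℚ
... | no p≢0 = (ℚ.1/ p) {{ℚ.≢-nonZero p≢0}}

recip-inverse : ∀ {p} → 0ℚ ℚ.< p → p ℚ.* recip p ≡ 1ℚ
recip-inverse {p} 0<p with p ℚ.≟ 0ℚ
... | yes p≡0 = contradiction (subst (0ℚ ℚ.<_) p≡0 0<p) (ℚ.<-irrefl refl)
... | no p≢0  = ℚ.*-inverseʳ p {{ℚ.≢-nonZero p≢0}}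

recip-pos : ∀ {p} → 0ℚ ℚ.< p → 0ℚ ℚ.< recip p
recip-pos {p} 0<p with p ℚ.≟ 0ℚ
... | yes p≡0 = contradiction (subst (0ℚ ℚ.<_) p≡0 0<p) (ℚ.<-irrefl refl)
... | no p≢0  = ℚ.positive⁻¹ _ {{1/pos {p} {{positive 0<p}} {{ℚ.≢-nonZero p≢0}}}}
  where
  1/pos : ∀ {p} {{_ : ℚ.Positive p}} .{{_ : ℚ.NonZero p}} → ℚ.Positive (ℚ.1/ p)
  1/pos {p} = ℚ.1/pos⇒pos p

------------------------------------------------------------------------
-- Real numbers: Cauchy sequences of rationals.  The existential in
-- `cauchy` carries a modulus of convergence.

record ℝ : Set where
  constructor mkℝ
  field
    seq    : ℕ → ℚ
    cauchy : ∀ ε → 0ℚ ℚ.< ε →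
             ∃[ N ] (∀ m n → N ℕ.≤ m → N ℕ.≤ n → ℚ.∣ seq m ℚ.- seq n ∣ ℚ.≤ ε)

open ℝ public

infix 4 _≃_ _≤_ _<_

_≃_ : ℝ → ℝ → Set
x ≃ y = ∀ ε → 0ℚ ℚ.< ε → ∃[ N ] (∀ n → N ℕ.≤ n → ℚ.∣ seq x n ℚ.- seq y n ∣ ℚ.≤ ε)

_≤_ : ℝ → ℝ → Set
x ≤ y = ∀ ε → 0ℚ ℚ.< ε → ∃[ N ] (∀ n → N ℕ.≤ n → seq x n ℚ.≤ seq y n ℚ.+ ε)

_<_ : ℝ → ℝ → Set
x < y = ∃[ ε ] (0ℚ ℚ.< ε × ∃[ N ] (∀ n → N ℕ.≤ n → seq x n ℚ.+ ε ℚ.≤ seq y n))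

fromℚ : ℚ → ℝ
fromℚ q = mkℝ (λ _ → q) λ ε 0<ε → 0 , λ _ _ _ _ →
  subst (ℚ._≤ ε) (cong ℚ.∣_∣ (sym (ℚ.+-inverseʳ q))) (ℚ.<⇒≤ 0<ε)

0ℝ 1ℝ 2ℝ : ℝ
0ℝ = fromℚ 0ℚ
1ℝ = fromℚ 1ℚ
2ℝ = fromℚ (+ 2 ℚ./ 1)

infix  8 -_
infixl 7 _*_
infixl 6 _+_ _-_

_+_ : ℝ → ℝ → ℝ
seq    (x + y) n = seq x n ℚ.+ seq y n
cauchy (x + y) ε 0<ε =
  let N₁ , h₁ = cauchy x (½ ℚ.* ε) (half-pos 0<ε)
      N₂ , h₂ = cauchy y (½ ℚ.* ε) (half-pos 0<ε)
  in N₁ ℕ.⊔ N₂ , λ m n N≤m N≤n → begin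
    ℚ.∣ (seq x m ℚ.+ seq y m) ℚ.- (seq x n ℚ.+ seq y n) ∣
      ≡⟨ cong ℚ.∣_∣ (solve 4 (λ a b c d → (a :+ b) :+ (:- (c :+ d)) := (a :+ (:- c)) :+ (b :+ (:- d)))
           refl (seq x m) (seq y m) (seq x n) (seq y n)) ⟩
    ℚ.∣ (seq x m ℚ.- seq x n) ℚ.+ (seq y m ℚ.- seq y n) ∣
      ≤⟨ ℚ.∣p+q∣≤∣p∣+∣q∣ (seq x m ℚ.- seq x n) (seq y m ℚ.- seq y n) ⟩
    ℚ.∣ seq x m ℚ.- seq x n ∣ ℚ.+ ℚ.∣ seq y m ℚ.- seq y n ∣
      ≤⟨ ℚ.+-mono-≤
           (h₁ m n (ℕ.m⊔n≤o⇒m≤o N₁ N₂ N≤m) (ℕ.m⊔n≤o⇒m≤o N₁ N₂ N≤n))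
           (h₂ m n (ℕ.m⊔n≤o⇒n≤o N₁ N₂ N≤m) (ℕ.m⊔n≤o⇒n≤o N₁ N₂ N≤n)) ⟩
    ½ ℚ.* ε ℚ.+ ½ ℚ.* ε
      ≡⟨ half+half ε ⟩
    ε ∎

-_ : ℝ → ℝ
seq    (- x) n = ℚ.- seq x n
cauchy (- x) ε 0<ε =
  let N , h = cauchy x ε 0<ε
  in N , λ m n N≤m N≤n → subst (ℚ._≤ ε)
       (trans (∣p-q∣≡∣q-p∣ (seq x m) (seq x n))
         (cong ℚ.∣_∣ (solve 2 (λ a b → b :+ (:- a) := (:- a) :+ (:- (:- b))) refl (seq x m) (seq x n))))
       (h m n N≤m N≤n)

_-_ : ℝ → ℝ → ℝ
x - y = x + (- y)

∣_∣ : ℝ → ℝ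
seq    ∣ x ∣ n = ℚ.∣ seq x n ∣
cauchy ∣ x ∣ ε 0<ε =
  let N , h = cauchy x ε 0<ε
  in N , λ m n N≤m N≤n →
       ℚ.≤-trans (∣∣p∣-∣q∣∣≤∣p-q∣ (seq x m) (seq x n)) (h m n N≤m N≤n)

bounded : ∀ x → ∃[ B ] (0ℚ ℚ.< B × ∃[ N ] (∀ n → N ℕ.≤ n → ℚ.∣ seq x n ∣ ℚ.≤ B))
bounded x =
  let N , h = cauchy x 1ℚ 0<1
  in ℚ.∣ seq x N ∣ ℚ.+ 1ℚ
   , ℚ.+-mono-≤-< {0ℚ} (ℚ.0≤∣p∣ (seq x N)) 0<1
   , N
   , λ n N≤n → ℚ.≤-trans (∣p∣≤∣q∣+∣p-q∣ (seq x n) (seq x N))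
       (ℚ.+-monoʳ-≤ ℚ.∣ seq x N ∣ (h n N N≤n ℕ.≤-refl))

_*_ : ℝ → ℝ → ℝ
seq    (x * y) n = seq x n ℚ.* seq y n
cauchy (x * y) ε 0<ε =
  let A , 0<A , Na , ha = bounded x
      B , 0<B , Nb , hb = bounded y
      δ₁ = ½ ℚ.* ε ℚ.* recip B
      δ₂ = ½ ℚ.* ε ℚ.* recip A
      0<δ₁ = *-0< (half-pos 0<ε) (recip-pos 0<B)
      0<δ₂ = *-0< (half-pos 0<ε) (recip-pos 0<A)
      N₁ , h₁ = cauchy x δ₁ 0<δ₁
      N₂ , h₂ = cauchy y δ₂ 0<δ₂
  in (Na ℕ.⊔ Nb) ℕ.⊔ (N₁ ℕ.⊔ N₂) , λ m n N≤m N≤n →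
    let Nab≤m = ℕ.m⊔n≤o⇒m≤o (Na ℕ.⊔ Nb) (N₁ ℕ.⊔ N₂) N≤m
        Nab≤n = ℕ.m⊔n≤o⇒m≤o (Na ℕ.⊔ Nb) (N₁ ℕ.⊔ N₂) N≤n
        N₁₂≤m = ℕ.m⊔n≤o⇒n≤o (Na ℕ.⊔ Nb) (N₁ ℕ.⊔ N₂) N≤m
        N₁₂≤n = ℕ.m⊔n≤o⇒n≤o (Na ℕ.⊔ Nb) (N₁ ℕ.⊔ N₂) N≤n
        xm = seq x m
        xn = seq x n
        ym = seq y m
        yn = seq y n
    in begin
    ℚ.∣ xm ℚ.* ym ℚ.- xn ℚ.* yn ∣
      ≡⟨ cong ℚ.∣_∣ (solve 4 (λ a b c d → a :* b :+ (:- (c :* d))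
             := (a :+ (:- c)) :* d :+ a :* (b :+ (:- d))) refl xm ym xn yn) ⟩
    ℚ.∣ (xm ℚ.- xn) ℚ.* yn ℚ.+ xm ℚ.* (ym ℚ.- yn) ∣
      ≤⟨ ℚ.∣p+q∣≤∣p∣+∣q∣ ((xm ℚ.- xn) ℚ.* yn) (xm ℚ.* (ym ℚ.- yn)) ⟩
    ℚ.∣ (xm ℚ.- xn) ℚ.* yn ∣ ℚ.+ ℚ.∣ xm ℚ.* (ym ℚ.- yn) ∣
      ≡⟨ cong₂ ℚ._+_ (ℚ.∣p*q∣≡∣p∣*∣q∣ (xm ℚ.- xn) yn) (ℚ.∣p*q∣≡∣p∣*∣q∣ xm (ym ℚ.- yn)) ⟩
    ℚ.∣ xm ℚ.- xn ∣ ℚ.* ℚ.∣ yn ∣ ℚ.+ ℚ.∣ xm ∣ ℚ.* ℚ.∣ ym ℚ.- yn ∣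
      ≤⟨ ℚ.+-mono-≤
           (*-mono (ℚ.0≤∣p∣ yn) (ℚ.<⇒≤ 0<δ₁)
             (h₁ m n (ℕ.m⊔n≤o⇒m≤o N₁ N₂ N₁₂≤m) (ℕ.m⊔n≤o⇒m≤o N₁ N₂ N₁₂≤n))
             (hb n (ℕ.m⊔n≤o⇒n≤o Na Nb Nab≤n)))
           (*-mono (ℚ.0≤∣p∣ (ym ℚ.- yn)) (ℚ.<⇒≤ 0<A)
             (ha m (ℕ.m⊔n≤o⇒m≤o Na Nb Nab≤m))
             (h₂ m n (ℕ.m⊔n≤o⇒n≤o N₁ N₂ N₁₂≤m) (ℕ.m⊔n≤o⇒n≤o N₁ N₂ N₁₂≤n))) ⟩
    δ₁ ℚ.* B ℚ.+ A ℚ.* δ₂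
      ≡⟨ solve 5 (λ h a a' b b' → h :* b' :* b :+ a :* (h :* a')
           := h :* (b :* b') :+ h :* (a :* a')) refl (½ ℚ.* ε) A (recip A) B (recip B) ⟩
    ½ ℚ.* ε ℚ.* (B ℚ.* recip B) ℚ.+ ½ ℚ.* ε ℚ.* (A ℚ.* recip A)
      ≡⟨ cong₂ (λ s t → ½ ℚ.* ε ℚ.* s ℚ.+ ½ ℚ.* ε ℚ.* t) (recip-inverse 0<B) (recip-inverse 0<A) ⟩
    ½ ℚ.* ε ℚ.* 1ℚ ℚ.+ ½ ℚ.* ε ℚ.* 1ℚ
      ≡⟨ solve 1 (λ e → con ½ :* e :* con 1ℚ :+ con ½ :* e :* con 1ℚ := e) refl ε ⟩
    ε ∎

inverse : (x : ℝ) → 0ℝ < x → ℝ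
seq    (inverse x _) n = recip (seq x n)
cauchy (inverse x (η , 0<η , N₀ , h₀)) ε 0<ε =
  let N , h = cauchy x (ε ℚ.* (η ℚ.* η)) (*-0< 0<ε (*-0< 0<η 0<η))
      r = recip η
      η≤ = λ n N₀≤n → subst (ℚ._≤ seq x n) (ℚ.+-identityˡ η) (h₀ n N₀≤n)
      recip-≤ = λ n N₀≤n → recip-anti 0<η (η≤ n N₀≤n)
      pos = λ n N₀≤n → ℚ.<-≤-trans 0<η (η≤ n N₀≤n)
  in N₀ ℕ.⊔ N , λ m n N≤m N≤n →
    let N₀≤m = ℕ.m⊔n≤o⇒m≤o N₀ N N≤m
        N₀≤n = ℕ.m⊔n≤o⇒m≤o N₀ N N≤n
        a = seq x m
        b = seq x n
        a' = recip a
        b' = recip b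
        0≤a' = ℚ.<⇒≤ (recip-pos (pos m N₀≤m))
        0≤b' = ℚ.<⇒≤ (recip-pos (pos n N₀≤n))
        0≤r  = ℚ.<⇒≤ (recip-pos 0<η)
    in begin
    ℚ.∣ a' ℚ.- b' ∣
      ≡⟨ cong ℚ.∣_∣ (diff-recip a b a' b' (recip-inverse (pos m N₀≤m)) (recip-inverse (pos n N₀≤n))) ⟩
    ℚ.∣ (b ℚ.- a) ℚ.* (a' ℚ.* b') ∣
      ≡⟨ ℚ.∣p*q∣≡∣p∣*∣q∣ (b ℚ.- a) (a' ℚ.* b') ⟩
    ℚ.∣ b ℚ.- a ∣ ℚ.* ℚ.∣ a' ℚ.* b' ∣
      ≡⟨ cong (ℚ.∣ b ℚ.- a ∣ ℚ.*_) (ℚ.0≤p⇒∣p∣≡p (*-0≤ 0≤a' 0≤b')) ⟩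
    ℚ.∣ b ℚ.- a ∣ ℚ.* (a' ℚ.* b')
      ≤⟨ *-mono (*-0≤ 0≤a' 0≤b') (ℚ.<⇒≤ (*-0< 0<ε (*-0< 0<η 0<η)))
           (h n m (ℕ.m⊔n≤o⇒n≤o N₀ N N≤n) (ℕ.m⊔n≤o⇒n≤o N₀ N N≤m))
           (*-mono 0≤b' 0≤r (recip-≤ m N₀≤m) (recip-≤ n N₀≤n)) ⟩
    ε ℚ.* (η ℚ.* η) ℚ.* (r ℚ.* r)
      ≡⟨ solve 3 (λ e h r → e :* (h :* h) :* (r :* r) := e :* ((h :* r) :* (h :* r))) refl ε η r ⟩
    ε ℚ.* ((η ℚ.* r) ℚ.* (η ℚ.* r))
      ≡⟨ cong (λ t → ε ℚ.* (t ℚ.* t)) (recip-inverse 0<η) ⟩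
    ε ℚ.* (1ℚ ℚ.* 1ℚ)
      ≡⟨ solve 1 (λ e → e :* (con 1ℚ :* con 1ℚ) := e) refl ε ⟩
    ε ∎
  where
  diff-recip : ∀ a b a' b' → a ℚ.* a' ≡ 1ℚ → b ℚ.* b' ≡ 1ℚ →
               a' ℚ.- b' ≡ (b ℚ.- a) ℚ.* (a' ℚ.* b')
  diff-recip a b a' b' e₁ e₂ = begin-equality
    a' ℚ.- b'
      ≡⟨ solve 2 (λ a' b' → a' :+ (:- b') := con 1ℚ :* a' :+ (:- (con 1ℚ :* b'))) refl a' b' ⟩
    1ℚ ℚ.* a' ℚ.- 1ℚ ℚ.* b'
      ≡⟨ cong₂ (λ s t → s ℚ.* a' ℚ.- t ℚ.* b') (sym e₂) (sym e₁) ⟩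
    b ℚ.* b' ℚ.* a' ℚ.- a ℚ.* a' ℚ.* b'
      ≡⟨ solve 4 (λ a b a' b' → b :* b' :* a' :+ (:- (a :* a' :* b'))
            := (b :+ (:- a)) :* (a' :* b')) refl a b a' b' ⟩
    (b ℚ.- a) ℚ.* (a' ℚ.* b') ∎

  recip-anti : ∀ {p q} → 0ℚ ℚ.< p → p ℚ.≤ q → recip q ℚ.≤ recip p
  recip-anti {p} {q} 0<p p≤q = begin
    recip q                          ≡⟨ ℚ.*-identityˡ (recip q) ⟨
    1ℚ ℚ.* recip q                   ≡⟨ cong (ℚ._* recip q) (recip-inverse 0<p) ⟨
    p ℚ.* recip p ℚ.* recip q        ≡⟨ ℚ.*-assoc p (recip p) (recip q) ⟩
    p ℚ.* (recip p ℚ.* recip q)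
      ≤⟨ ℚ.*-monoʳ-≤-nonNeg _ {{nonNegative (*-0≤ (ℚ.<⇒≤ (recip-pos 0<p)) (ℚ.<⇒≤ (recip-pos 0<q)))}} p≤q ⟩
    q ℚ.* (recip p ℚ.* recip q)
      ≡⟨ solve 3 (λ q a b → q :* (a :* b) := (q :* b) :* a) refl q (recip p) (recip q) ⟩
    q ℚ.* recip q ℚ.* recip p        ≡⟨ cong (ℚ._* recip p) (recip-inverse 0<q) ⟩
    1ℚ ℚ.* recip p                   ≡⟨ ℚ.*-identityˡ (recip p) ⟩
    recip p                          ∎
    where
    0<q : 0ℚ ℚ.< q
    0<q = ℚ.<-≤-trans 0<p p≤q

infixl 7 _/_[_]

_/_[_] : (x y : ℝ) → 0ℝ < y → ℝ
x / y [ 0<y ] = x * inverse y 0<y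

*-inverse : ∀ x (0<x : 0ℝ < x) → x * inverse x 0<x ≃ 1ℝ
*-inverse x (η , 0<η , N₀ , h₀) ε 0<ε = N₀ , λ n N₀≤n →
  subst (ℚ._≤ ε)
    (cong (λ t → ℚ.∣ t ℚ.- 1ℚ ∣)
      (sym (recip-inverse (ℚ.<-≤-trans 0<η
        (subst (ℚ._≤ seq x n) (ℚ.+-identityˡ η) (h₀ n N₀≤n))))))
    (ℚ.<⇒≤ 0<ε)

0<2 : 0ℝ < 2ℝ
0<2 = 1ℚ , 0<1 , 0 , λ _ _ → subst (ℚ._≤ + 2 ℚ./ 1) (sym (ℚ.+-identityˡ 1ℚ)) 1≤2
  where
  1≤2 : 1ℚ ℚ.≤ + 2 ℚ./ 1
  1≤2 = ℚ.+-mono-≤ {0ℚ} {1ℚ} (ℚ.<⇒≤ 0<1) (ℚ.≤-refl {1ℚ})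

------------------------------------------------------------------------
-- √2, as the limit of x₀ = 1, xₙ₊₁ = xₙ + (2 − xₙ²)/4; that the limit
-- is the positive square root of 2 is proved in √2*√2≃2 and 0<√2.

private
  2ℚ ¼ 1/16 : ℚ
  2ℚ   = + 2 ℚ./ 1
  ¼    = + 1 ℚ./ 4
  1/16 = + 1 ℚ./ 16

√2-approx : ℕ → ℚ
√2-approx zero    = 1ℚ
√2-approx (suc n) = let x = √2-approx n in x ℚ.+ (+ 1 ℚ./ 4) ℚ.* ((+ 2 ℚ./ 1) ℚ.- x ℚ.* x)

module √2-Facts where

  err : ℚ → ℚ
  err x = 2ℚ ℚ.- x ℚ.* x

  halves : ℕ → ℚ
  halves zero    = 1ℚ
  halves (suc n) = ½ ℚ.* halves n

  0≤sq : ∀ p → 0ℚ ℚ.≤ p ℚ.* p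
  0≤sq p with ℚ.≤-total 0ℚ p
  ... | inj₁ 0≤p = *-0≤ 0≤p 0≤p
  ... | inj₂ p≤0 = subst (0ℚ ℚ.≤_)
    (solve 1 (λ p → (:- p) :* (:- p) := p :* p) refl p)
    (*-0≤ (ℚ.neg-antimono-≤ p≤0) (ℚ.neg-antimono-≤ p≤0))

  approx-inv : ∀ n → let x = √2-approx n in
               1ℚ ℚ.≤ x × 0ℚ ℚ.≤ err x × err x ℚ.≤ halves n
  approx-inv zero = ℚ.≤-refl , ℚ.<⇒≤ 0<1 , ℚ.≤-refl
  approx-inv (suc n) with √2-approx n | approx-inv n
  ... | x | 1≤x , 0≤e , e≤h = 1≤x' , 0≤e' , e'≤h'
    where
    e  = err x
    x' = x ℚ.+ ¼ ℚ.* e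

    0≤c : ∀ c {{_ : ℚ.Positive c}} → 0ℚ ℚ.≤ c
    0≤c c = ℚ.<⇒≤ (ℚ.positive⁻¹ c)

    1≤x' : 1ℚ ℚ.≤ x'
    1≤x' = ℚ.+-mono-≤ {1ℚ} {x} {0ℚ} 1≤x (*-0≤ (0≤c ¼) 0≤e)

    0≤e' : 0ℚ ℚ.≤ err x'
    0≤e' = subst (0ℚ ℚ.≤_)
      (solve 1 (λ x → let e = con 2ℚ :+ (:- (x :* x)) ; x' = x :+ con ¼ :* e in
         e :* (con ¼ :* ((x :+ (:- con 1ℚ)) :* (x :+ (:- con 1ℚ))) :+ con ¼ :+ con (+ 3 ℚ./ 16) :* e)
         := con 2ℚ :+ (:- (x' :* x'))) refl x)
      (*-0≤ 0≤e (+-0≤ (+-0≤ (*-0≤ (0≤c ¼) (0≤sq (x ℚ.- 1ℚ))) (0≤c ¼)) (*-0≤ (0≤c (+ 3 ℚ./ 16)) 0≤e)))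

    e'≤½e : err x' ℚ.≤ ½ ℚ.* e
    e'≤½e = diff-≤ (subst (0ℚ ℚ.≤_)
      (solve 1 (λ x → let e = con 2ℚ :+ (:- (x :* x)) ; x' = x :+ con ¼ :* e in
         e :* (con ½ :* (x :+ (:- con 1ℚ)) :+ con 1/16 :* e)
         := con ½ :* e :+ (:- (con 2ℚ :+ (:- (x' :* x'))))) refl x)
      (*-0≤ 0≤e (+-0≤ (*-0≤ (0≤c ½) (0≤-diff 1≤x)) (*-0≤ (0≤c 1/16) 0≤e))))

    e'≤h' : err x' ℚ.≤ ½ ℚ.* halves n
    e'≤h' = ℚ.≤-trans e'≤½e (ℚ.*-monoˡ-≤-nonNeg ½ e≤h)

  halves-pos : ∀ n → 0ℚ ℚ.< halves n
  halves-pos zero    = 0<1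
  halves-pos (suc n) = half-pos (halves-pos n)

  halves-anti : ∀ {m n} → m ℕ.≤′ n → halves n ℚ.≤ halves m
  halves-anti ℕ.≤′-refl = ℚ.≤-refl
  halves-anti {m} {suc n} (ℕ.≤′-step m≤n) = ℚ.≤-trans step (halves-anti m≤n)
    where
    step : ½ ℚ.* halves n ℚ.≤ halves n
    step = subst (½ ℚ.* halves n ℚ.≤_) (half+half (halves n))
      (subst (ℚ._≤ ½ ℚ.* halves n ℚ.+ ½ ℚ.* halves n) (ℚ.+-identityʳ _)
        (ℚ.+-monoʳ-≤ (½ ℚ.* halves n) (ℚ.<⇒≤ (halves-pos (suc n)))))

  fromNat : ℕ → ℚ
  fromNat zero    = 0ℚ
  fromNat (suc n) = 1ℚ ℚ.+ fromNat n

  0≤fromNat : ∀ n → 0ℚ ℚ.≤ fromNat n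
  0≤fromNat zero    = ℚ.≤-refl
  0≤fromNat (suc n) = +-0≤ (ℚ.<⇒≤ 0<1) (0≤fromNat n)

  -- halves n ≤ 1/(n+1)
  halves-bound : ∀ n → halves n ℚ.* fromNat (suc n) ℚ.≤ 1ℚ
  halves-bound zero    = ℚ.≤-refl
  halves-bound (suc n) = ℚ.≤-trans
    (diff-≤ (subst (0ℚ ℚ.≤_)
      (solve 2 (λ h k → con ½ :* h :* k
        := h :* (con 1ℚ :+ k) :+ (:- (con ½ :* h :* (con 1ℚ :+ (con 1ℚ :+ k))))) refl
        (halves n) (fromNat n))
      (*-0≤ (ℚ.<⇒≤ (halves-pos (suc n))) (0≤fromNat n))))
    (halves-bound n)

  toℚᵘ-fromNat : ∀ n → ℚ.toℚᵘ (fromNat n) ℚᵘ.≃ mkℚᵘ (+ n) 0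
  toℚᵘ-fromNat zero    = ℚᵘ.≃-refl
  toℚᵘ-fromNat (suc n) = ℚᵘ.≃-trans (ℚ.toℚᵘ-homo-+ 1ℚ (fromNat n))
    (ℚᵘ.≃-trans (ℚᵘ.+-congʳ (mkℚᵘ (+ 1) 0) (toℚᵘ-fromNat n))
      (ℚᵘ.*≡* (cong (λ k → (+ 1 ℤ.+ k) ℤ.* + 1) (ℤ.*-identityʳ (+ n)))))

  ≤-fromNat : ∀ q → q ℚ.≤ fromNat ℤ.∣ ℚ.numerator q ∣
  ≤-fromNat q@(mkℚ (+ n) d _) = ℚ.toℚᵘ-cancel-≤ (ℚᵘ.≤-respʳ-≃ (ℚᵘ.≃-sym (toℚᵘ-fromNat n))
    (ℚᵘ.*≤* (ℤ.*-monoˡ-≤-nonNeg (+ n) (ℤ.+≤+ (ℕ.s≤s ℕ.z≤n)))))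
  ≤-fromNat q@(mkℚ -[1+ n ] d _) = ℚ.≤-trans {q} {0ℚ}
    (ℚ.nonPositive⁻¹ q) (0≤fromNat (suc n))

  halves-→0 : ∀ ε → 0ℚ ℚ.< ε → ∃[ N ] halves N ℚ.≤ ε
  halves-→0 ε 0<ε = N , (begin
    halves N
      ≡⟨ ℚ.*-identityʳ (halves N) ⟨
    halves N ℚ.* 1ℚ
      ≡⟨ cong (halves N ℚ.*_) (recip-inverse 0<ε) ⟨
    halves N ℚ.* (ε ℚ.* recip ε)
      ≡⟨ solve 3 (λ h e r → h :* (e :* r) := (h :* r) :* e) refl (halves N) ε (recip ε) ⟩
    halves N ℚ.* recip ε ℚ.* ε
      ≤⟨ ℚ.*-monoʳ-≤-nonNeg ε {{nonNegative (ℚ.<⇒≤ 0<ε)}} (ℚ.≤-trans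
           (ℚ.*-monoˡ-≤-nonNeg (halves N) {{nonNegative (ℚ.<⇒≤ (halves-pos N))}} recip≤)
           (halves-bound N)) ⟩
    1ℚ ℚ.* ε
      ≡⟨ ℚ.*-identityˡ ε ⟩
    ε ∎)
    where
    N = ℤ.∣ ℚ.numerator (recip ε) ∣

    recip≤ : recip ε ℚ.≤ fromNat (suc N)
    recip≤ = ℚ.≤-trans (≤-fromNat (recip ε))
      (subst (ℚ._≤ fromNat (suc N)) (ℚ.+-identityˡ (fromNat N))
        (ℚ.+-monoˡ-≤ (fromNat N) (ℚ.<⇒≤ 0<1)))

  gap : ∀ {u v δ} → 1ℚ ℚ.≤ u → 1ℚ ℚ.≤ v → 0ℚ ℚ.≤ err u → 0ℚ ℚ.≤ err v → err v ℚ.≤ δ →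
        u ℚ.- v ℚ.≤ δ
  gap {u} {v} {δ} 1≤u 1≤v 0≤eu 0≤ev ev≤δ with ℚ.≤-total u v
  ... | inj₁ u≤v = ℚ.≤-trans
    (diff-≤ (subst (0ℚ ℚ.≤_) (solve 2 (λ u v → v :+ (:- u) := con 0ℚ :+ (:- (u :+ (:- v)))) refl u v)
      (0≤-diff u≤v)))
    (ℚ.≤-trans 0≤ev ev≤δ)
  ... | inj₂ v≤u = ℚ.≤-trans
    (diff-≤ (subst (0ℚ ℚ.≤_)
      (solve 2 (λ u v →
        (u :+ (:- v)) :* ((u :+ (:- con 1ℚ)) :+ (v :+ (:- con 1ℚ)) :+ con 1ℚ) :+ (con 2ℚ :+ (:- (u :* u)))
        := (con 2ℚ :+ (:- (v :* v))) :+ (:- (u :+ (:- v)))) refl u v)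
      (+-0≤ (*-0≤ (0≤-diff v≤u)
        (+-0≤ (+-0≤ (0≤-diff 1≤u) (0≤-diff 1≤v)) (ℚ.<⇒≤ 0<1))) 0≤eu)))
    ev≤δ

open √2-Facts

√2 : ℝ
seq    √2 = √2-approx
cauchy √2 ε 0<ε =
  let N , h = halves-→0 ε 0<ε
      err≤ε = λ n N≤n → ℚ.≤-trans (proj₂ (proj₂ (approx-inv n)))
                (ℚ.≤-trans (halves-anti (ℕ.≤⇒≤′ N≤n)) h)
      1≤ = λ n → proj₁ (approx-inv n)
      0≤ = λ n → proj₁ (proj₂ (approx-inv n))
  in N , λ m n N≤m N≤n → ∣∣-≤
       (gap (1≤ m) (1≤ n) (0≤ m) (0≤ n) (err≤ε n N≤n))
       (subst (ℚ._≤ ε)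
         (solve 2 (λ a b → b :+ (:- a) := :- (a :+ (:- b))) refl (√2-approx m) (√2-approx n))
         (gap (1≤ n) (1≤ m) (0≤ n) (0≤ m) (err≤ε m N≤m)))

√2*√2≃2 : √2 * √2 ≃ 2ℝ
√2*√2≃2 ε 0<ε =
  let N , h = halves-→0 ε 0<ε
  in N , λ n N≤n →
    let x = √2-approx n
        _ , 0≤e , e≤h = approx-inv n
    in subst (ℚ._≤ ε)
         (trans (sym (ℚ.0≤p⇒∣p∣≡p 0≤e)) (∣p-q∣≡∣q-p∣ 2ℚ (x ℚ.* x)))
         (ℚ.≤-trans e≤h (ℚ.≤-trans (halves-anti (ℕ.≤⇒≤′ N≤n)) h))

0<√2 : 0ℝ < √2
0<√2 = 1ℚ , 0<1 , 0 , λ n _ →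
  subst (ℚ._≤ √2-approx n) (sym (ℚ.+-identityˡ 1ℚ)) (proj₁ (approx-inv n))

record Matrix : Set where
  constructor ⟦_,_⨾_,_⟧
  field
    e₁₁ e₁₂ e₂₁ e₂₂ : ℝ

infix 4 _≈±_

-- Equality in PSL₂(ℝ): equality of matrices up to a common sign.
_≈±_ : Matrix → Matrix → Set
⟦ a , b ⨾ c , d ⟧ ≈± ⟦ a' , b' ⨾ c' , d' ⟧ =
  (a ≃ a' × b ≃ b' × c ≃ c' × d ≃ d') ⊎
  (a ≃ - a' × b ≃ - b' × c ≃ - c' × d ≃ - d')

identity : Matrix
identity = ⟦ 1ℝ , 0ℝ ⨾ 0ℝ , 1ℝ ⟧

infixl 7 _·_

_·_ : Matrix → Matrix → Matrix
⟦ a , b ⨾ c , d ⟧ · ⟦ a' , b' ⨾ c' , d' ⟧ =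
  ⟦ a * a' + b * c' , a * b' + b * d' ⨾ c * a' + d * c' , c * b' + d * d' ⟧

-- The inverse of a matrix of determinant 1.
adjugate : Matrix → Matrix
adjugate ⟦ a , b ⨾ c , d ⟧ = ⟦ d , - b ⨾ - c , a ⟧

-- The subgroup of PSL₂(ℝ) generated by the two given matrices.  Both have
-- determinant 1, hence so do all members, and `adjugate` inverts them.
data H₄ : Matrix → Set where
  translation : H₄ ⟦ 1ℝ , √2 ⨾ 0ℝ , 1ℝ ⟧
  involution  : H₄ ⟦ 0ℝ , - 1ℝ ⨾ 1ℝ , 0ℝ ⟧
  unit        : H₄ identity
  product     : ∀ {A B} → H₄ A → H₄ B → H₄ (A · B)
  invert      : ∀ {A} → H₄ A → H₄ (adjugate A)
  respects    : ∀ {A B} → A ≈± B → H₄ A → H₄ B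

-- p/q ∈ ℚ(H₄) is a finite element in normalized form.
record Normalized (p q : ℝ) : Set where
  constructor normalized
  field
    r s   : ℝ
    in-H₄ : H₄ ⟦ p , r ⨾ q , s ⟧
    0<q   : 0ℝ < q

-- The finite elements of ℚ(H₄).  A finite p/q has q ≠ 0, and the sign of
-- (p, q) is free in PSL₂(ℝ), so it has a normalized form.
_∈ℚ[H₄] : ℝ → Set
α ∈ℚ[H₄] = ∃[ p ] ∃[ q ] Σ (Normalized p q) λ n → α ≃ p / q [ Normalized.0<q n ]

------------------------------------------------------------------------
-- Infima.  Constructively the infimum of a set of reals need not be a
-- Cauchy real, but it always exists as an (extended) upper real, that is,
-- as an open upper set of rationals: those strictly above it.  The set may
-- be empty (+∞) or everything (−∞); x ≤ᵁ y reverses inclusion.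

record UpperReal : Set₁ where
  field
    Above  : ℚ → Set
    upward : ∀ {r s} → r ℚ.≤ s → Above r → Above s
    open-  : ∀ {r} → Above r → ∃[ s ] (s ℚ.< r × Above s)

infix 4 _≤ᵁ_ _≃ᵁ_

_≤ᵁ_ : UpperReal → UpperReal → Set
x ≤ᵁ y = ∀ r → UpperReal.Above y r → UpperReal.Above x r

_≃ᵁ_ : UpperReal → UpperReal → Set
x ≃ᵁ y = x ≤ᵁ y × y ≤ᵁ x

private
  <-upward : ∀ {x r s} → r ℚ.≤ s → x < fromℚ r → x < fromℚ s
  <-upward r≤s (ε , 0<ε , N , h) = ε , 0<ε , N , λ n N≤n → ℚ.≤-trans (h n N≤n) r≤s

  <-open : ∀ {x r} → x < fromℚ r → ∃[ s ] (s ℚ.< r × x < fromℚ s)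
  <-open {x} {r} (ε , 0<ε , N , h) = r ℚ.- δ , s<r , δ , half-pos 0<ε , N , λ n N≤n →
    diff-≤ (subst (0ℚ ℚ.≤_)
      (solve 3 (λ x r e → r :+ (:- (x :+ e))
        := (r :+ (:- (con ½ :* e))) :+ (:- (x :+ con ½ :* e))) refl (seq x n) r ε)
      (0≤-diff (h n N≤n)))
    where
    δ = ½ ℚ.* ε

    s<r : r ℚ.- δ ℚ.< r
    s<r = subst (r ℚ.- δ ℚ.<_) (ℚ.+-identityʳ r)
      (ℚ.+-monoʳ-< r (ℚ.neg-antimono-< (half-pos 0<ε)))

fromℝ : ℝ → UpperReal
fromℝ x = record
  { Above  = λ r → x < fromℚ r
  ; upward = <-upward {x}
  ; open-  = <-open {x}
  }

inf : (ℝ → Set) → UpperReal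
inf S = record
  { Above  = λ r → ∃[ k ] (S k × k < fromℚ r)
  ; upward = λ r≤s (k , Sk , k<r) → k , Sk , <-upward {k} r≤s k<r
  ; open-  = λ (k , Sk , k<r) →
      let s , s<r , k<s = <-open {k} k<r in s , s<r , k , Sk , k<s
  }

Admissible : ℝ → ℝ → Set
Admissible α k = 0ℝ < k ×
  ∃[ N₀ ] (∀ N → N₀ ≤ N → (0<N : 0ℝ < N) →
    ∃[ p ] ∃[ q ] (Normalized p q × ∣ q * α - p ∣ < k / N [ 0<N ] × 1ℝ ≤ q × q ≤ N))

K : ℝ → UpperReal
K α = inf (Admissible α)

{-# OPTIONS --safe #-}
module Submission where

-- Let κ = (√2 + 1)/2.
--
-- K(α) ≤ κ for every α.  The two columns v , w of a matrix in H₄ have as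
-- neighbours √2 v + w and v + √2 w.  Starting from ∞ and 0 and always passing to
-- the part that contains α, one reaches adjacent v , w with denominators q , q' ≤ N
-- whose two mediants do not both fit below N.  The distances x = |qα − p| and
-- x' = |q'α − p'| satisfy q'x + qx' = 1.  If both mediants exceed N, then adding
-- √2 q + q' > N and q + √2 q' > N gives q + q' > N/κ, so x and x' cannot both
-- exceed κ/N; if only one does, the same argument with the fitting mediant gives a
-- better constant.  Upper reals leave room above κ, so α/√2, N and √2 may be
-- replaced by rational approximations and every comparison becomes decidable.
--
-- K(1) ≥ κ.  The first column (p , q) of a matrix in H₄ consists of s and √2 t in
-- one order or the other, with s an odd integer and t an integer.  If q ≤ N and
-- |q − p| < κ/N then the odd number s² − 2t² has absolute value < 3, so it is ±1 and
-- s + t √2 is a power of 1 + √2.  For N just below the next power's s, this forces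
-- |q − p| ≥ (1 + √2)⁻ⁿ with N ~ (1 + √2)ⁿ⁺¹/2.

open import Data.Empty using (⊥; ⊥-elim)
open import Data.Integer as ℤ using (+_)
open import Data.Nat as ℕ using (ℕ; zero; suc)
import Data.Nat.Properties as ℕ
import Data.Nat.Solver
open import Data.Product using (∃-syntax; _×_; _,_; proj₁; proj₂)
open import Data.Rational as ℚ using (ℚ; 0ℚ; 1ℚ; ½)
import Data.Rational.Properties as ℚ
open import Data.Rational.Solver using (module +-*-Solver)
open import Data.Sum as Sum using (_⊎_; inj₁; inj₂; swap)
open import Function using (_∘_)
open import Relation.Binary.PropositionalEquality
  using (_≡_; refl; sym; trans; cong; cong₂; subst; subst₂)
open import Relation.Nullary using (¬_; Dec; yes; no)
open import Relation.Nullary.Decidable using (toWitness)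

-- Natural solutions of s² - 2t² = ±1.

module Pell where
  open import Data.Nat
  open Data.Nat.Solver.+-*-Solver using (solve; _:=_; _:+_; _:*_; con)

  -- (1 + √2)ⁿ = S n + T n √2
  S T : ℕ → ℕ
  S zero    = 1
  S (suc n) = S n + (T n + T n)
  T zero    = 0
  T (suc n) = S n + T n

  -- The equation s² - 2t² = ±1 without subtraction: norm 1 on the left, norm -1 on the right.
  IsPell : ℕ → ℕ → Set
  IsPell s t = (s * s ≡ suc (t * t + t * t)) ⊎ (suc (s * s) ≡ t * t + t * t)

  square-sum : ∀ s t → (s + (t + t)) * (s + (t + t)) + s * s
    ≡ ((s + t) * (s + t) + (s + t) * (s + t)) + (t * t + t * t)
  square-sum = solve 2 (λ s t → (s :+ (t :+ t)) :* (s :+ (t :+ t)) :+ s :* s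
    := ((s :+ t) :* (s :+ t) :+ (s :+ t) :* (s :+ t)) :+ (t :* t :+ t :* t)) refl

  -- Read as differences, X - Y = -(x - y). With `square-sum` this says that multiplication by 1 +
  -- √2, whose norm is -1, reverses the sign of the norm.
  flip : ∀ {X Y x y} → X + x ≡ Y + y → (x ≡ suc y ⊎ suc x ≡ y) → (X ≡ suc Y ⊎ suc X ≡ Y)
  flip {X} {Y} {y = y} eq (inj₁ refl) = inj₂ (ℕ.+-cancelʳ-≡ y (suc X) Y
    (trans (sym (ℕ.+-suc X y)) eq))
  flip {X} {Y} {x = x} eq (inj₂ refl) = inj₁ (ℕ.+-cancelʳ-≡ x X (suc Y)
    (trans eq (ℕ.+-suc Y x)))

  pell-up : ∀ s t → IsPell s t → IsPell (s + (t + t)) (s + t)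
  pell-up s t = flip (square-sum s t)

  pell-down : ∀ s t → IsPell (s + (t + t)) (s + t) → IsPell s t
  pell-down s t = flip (trans (ℕ.+-comm (s * s) _) (trans (square-sum s t) (ℕ.+-comm _ (t * t + t * t))))

  pell : ∀ n → IsPell (S n) (T n)
  pell zero    = inj₁ refl
  pell (suc n) = pell-up (S n) (T n) (pell n)

  t≤s : ∀ s t → IsPell s t → t ≤ s
  t≤s s t h = ℕ.≮⇒≥ λ s<t → below (ℕ.m+[n∸m]≡n s<t) h
    where
    below : ∀ {r} → suc s + r ≡ t → IsPell s t → ⊥
    below {r} refl (inj₁ eq) = ℕ.m≢1+m+n (s * s) (trans eq
      (solve 2 (λ s r → con 1 :+ ((con 1 :+ s :+ r) :* (con 1 :+ s :+ r) :+ (con 1 :+ s :+ r) :* (con 1 :+ s :+ r))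
        := con 1 :+ (s :* s :+ (con 2 :+ con 4 :* s :+ s :* s :+ con 4 :* r :+ con 4 :* s :* r :+ con 2 :* r :* r)))
        refl s r))
    below {r} refl (inj₂ eq) = ℕ.m≢1+m+n (suc (s * s)) (trans eq
      (solve 2 (λ s r → (con 1 :+ s :+ r) :* (con 1 :+ s :+ r) :+ (con 1 :+ s :+ r) :* (con 1 :+ s :+ r)
        := con 1 :+ ((con 1 :+ s :* s) :+ (con 4 :* s :+ s :* s :+ con 4 :* r :+ con 4 :* s :* r :+ con 2 :* r :* r)))
        refl s r))

  s≤2t : ∀ {t u} → IsPell (suc t + u) (suc t) → u ≤ suc t
  s≤2t {t} {u} h = ℕ.≮⇒≥ λ t<u → above (ℕ.m+[n∸m]≡n t<u) h
    where
    above : ∀ {r} → suc (suc t) + r ≡ u → IsPell (suc t + u) (suc t) → ⊥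
    above {r} refl (inj₁ eq) = ℕ.m≢1+m+n (suc (suc t * suc t + suc t * suc t)) (trans (sym eq)
      (solve 2 (λ t r → let t' = con 1 :+ t in
        (t' :+ (con 1 :+ t' :+ r)) :* (t' :+ (con 1 :+ t' :+ r))
        := con 1 :+ ((con 1 :+ (t' :* t' :+ t' :* t'))
             :+ (con 5 :+ con 8 :* t :+ con 2 :* t :* t :+ con 4 :* t' :* r :+ con 2 :* r :+ r :* r)))
        refl t r))
    above {r} refl (inj₂ eq) = ℕ.m≢1+m+n (suc t * suc t + suc t * suc t) (trans (sym eq)
      (solve 2 (λ t r → let t' = con 1 :+ t in
        con 1 :+ (t' :+ (con 1 :+ t' :+ r)) :* (t' :+ (con 1 :+ t' :+ r))
        := con 1 :+ ((t' :* t' :+ t' :* t')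
             :+ (con 1 :+ con 2 :* t' :* t' :+ con 4 :* t' :+ con 4 :* t' :* r :+ con 2 :* r :+ r :* r)))
        refl t r))

  -- Descent by division by 1 + √2, which sends (s , t) to (2t - s , s - t). The bounds t ≤ s ≤ 2t
  -- keep both entries natural, and t drops at each division, so `fuel` only has to bound t.
  pell-solutions : ∀ fuel {s t} → t ≤ fuel → IsPell s t → ∃[ j ] (s ≡ S j × t ≡ T j)
  pell-solutions _ {s} {zero} _ (inj₁ eq) = 0 , ℕ.m*n≡1⇒m≡1 s s eq , refl
  pell-solutions (suc fuel) {s} {t@(suc t-1)} (s≤s t-1≤fuel) h = step u v s≡ t≡ (subst₂ IsPell s≡ t≡ h)
    where
    u = s ∸ t
    v = t ∸ u

    t+u≡s : t + u ≡ s
    t+u≡s = ℕ.m+[n∸m]≡n (t≤s s t h)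

    t≡ : t ≡ v + u
    t≡ = sym (ℕ.m∸n+n≡m (s≤2t (subst (λ s → IsPell s t) (sym t+u≡s) h)))

    s≡ : s ≡ v + (u + u)
    s≡ = trans (sym t+u≡s) (trans (cong (_+ u) t≡) (ℕ.+-assoc v u u))

    step : ∀ u v → s ≡ v + (u + u) → t ≡ v + u → IsPell (v + (u + u)) (v + u) →
           ∃[ j ] (s ≡ S j × t ≡ T j)
    -- Only v > 0 makes t drop; v = 0 would mean t = 0 or the impossible solution (0 , u) with u >
    -- 0.
    step zero zero _ () _
    step (suc u) zero _ _ h' with () ← t≤s 0 (suc u) (pell-down 0 (suc u) h')
    step u v@(suc v-1) s≡ t≡ h' =
      let h'' = pell-down v u h'
          j , e₁ , e₂ = pell-solutions fuel (ℕ.≤-trans (ℕ.≤-trans (ℕ.m≤n+m u v-1)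
                             (ℕ.≤-reflexive (ℕ.suc-injective (sym t≡)))) t-1≤fuel) h''
      in suc j , trans s≡ (cong₂ (λ s t → s + (t + t)) e₁ e₂) , trans t≡ (cong₂ _+_ e₁ e₂)

  S-mono : ∀ {i j} → i ≤′ j → S i ≤ S j
  S-mono ≤′-refl = ℕ.≤-refl
  S-mono (≤′-step i≤j) = ℕ.≤-trans (S-mono i≤j) (ℕ.m≤m+n _ _)

  n≤S : ∀ n → n ≤ S n
  n≤S n = ℕ.≤-trans (n≤T n) (t≤s (S n) (T n) (pell n))
    where
    1≤S : ∀ n → 1 ≤ S n
    1≤S n = S-mono {0} {n} (ℕ.≤⇒≤′ z≤n)

    n≤T : ∀ n → n ≤ T n
    n≤T zero    = z≤n
    n≤T (suc n) = ℕ.+-mono-≤ (1≤S n) (n≤T n)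

  -- Every solution is some `(S j , T j)` and `S` is monotone, so no solution has s strictly between
  -- `S n` and `S (suc n)`.
  s≤S : ∀ {s t} n → IsPell s t → s < S (suc n) → s ≤ S n
  s≤S {s} {t} n h s<S with pell-solutions t {s} ℕ.≤-refl h
  ... | j , refl , _ with ℕ.≤-<-connex j n
  ... | inj₁ j≤n = S-mono (ℕ.≤⇒≤′ j≤n)
  ... | inj₂ n<j = ⊥-elim (ℕ.<⇒≱ s<S (S-mono (ℕ.≤⇒≤′ n<j)))

  -- Since s² = 2m + 1, halving the two bounds leaves m ≤ t² ≤ m + 1, and the two possible values of
  -- t² are the two signs of the norm.
  odd-near : ∀ y t → let s = suc (y + y) in
             s * s < t * t + t * t + 3 → t * t + t * t < s * s + 3 → IsPell s t
  odd-near y t lt gt = decide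
    (half≤ (subst (_< t * t + t * t + 3) square lt))
    (half≤' (subst (λ q → t * t + t * t < q + 3) square gt))
    where
    m = 2 * (y * y) + 2 * y
    square : suc (y + y) * suc (y + y) ≡ suc (m + m)
    square = solve 1 (λ y → let m = con 2 :* (y :* y) :+ con 2 :* y in
      (con 1 :+ (y :+ y)) :* (con 1 :+ (y :+ y)) := con 1 :+ (m :+ m)) refl y

    halve : ∀ a b → a + a < b + b + 2 → a ≤ b
    halve a b h = ℕ.≮⇒≥ λ b<a → ℕ.<⇒≱ h (ℕ.≤-trans (ℕ.≤-reflexive
      (solve 1 (λ b → b :+ b :+ con 2 := (con 1 :+ b) :+ (con 1 :+ b)) refl b)) (ℕ.+-mono-≤ b<a b<a))

    half≤ : suc (m + m) < t * t + t * t + 3 → m ≤ t * t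
    half≤ h = halve m (t * t) (ℕ.≤-pred (ℕ.≤-trans h (ℕ.≤-reflexive (ℕ.+-suc (t * t + t * t) 2))))

    half≤' : t * t + t * t < suc (m + m) + 3 → t * t ≤ suc m
    half≤' h = halve (t * t) (suc m) (ℕ.≤-trans h (ℕ.≤-reflexive
      (solve 1 (λ m → con 1 :+ (m :+ m) :+ con 3 := (con 1 :+ m) :+ (con 1 :+ m) :+ con 2) refl m)))

    decide : m ≤ t * t → t * t ≤ suc m → IsPell (suc (y + y)) t
    decide m≤ ≤m with ℕ.m≤n⇒m<n∨m≡n m≤
    ... | inj₂ m≡ = inj₁ (trans square (cong (λ q → suc (q + q)) m≡))
    ... | inj₁ m< = inj₂ (trans (cong suc square) (trans (cong suc (sym (ℕ.+-suc m m)))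
                      (cong (λ q → q + q) (ℕ.≤-antisym m< ≤m))))

open +-*-Solver using (solve; _:=_; _:+_; _:*_; :-_; con)
import Defs
open Defs.ℚ-Facts
open Defs.√2-Facts using (fromNat; 0≤fromNat; ≤-fromNat)

-- Rational inequalities by certificates, and the descent along adjacent vectors.

module Rationals where
  open import Data.Rational

  2ℚ : ℚ
  2ℚ = + 2 / 1

  -- The pattern of nearly all estimates below: q - p is exhibited as an expression `e` that is
  -- visibly nonnegative, built from the hypotheses, and the ring solver checks the identity. `⊥-by`
  -- does the same for contradictions, with a positive combination of hypotheses that collapses to
  -- 0.
  ≤-by : ∀ {p q e} → 0ℚ ≤ e → e ≡ q - p → p ≤ q
  ≤-by 0≤e eq = diff-≤ (subst (0ℚ ≤_) eq 0≤e)

  <-by : ∀ {p q e} → 0ℚ < e → e ≡ q - p → p < q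
  <-by {p} {q} 0<e eq = subst₂ _<_ (ℚ.+-identityˡ p)
    (solve 2 (λ p q → (q :+ (:- p)) :+ p := q) refl p q)
    (ℚ.+-monoˡ-< p (subst (0ℚ <_) eq 0<e))

  ⊥-by : ∀ {e} → 0ℚ < e → e ≡ 0ℚ → ⊥
  ⊥-by 0<e eq = ℚ.<-irrefl refl (subst (0ℚ <_) eq 0<e)

  0<-diff : ∀ {p q} → p < q → 0ℚ < q - p
  0<-diff {p} {q} p<q = subst (_< q - p) (ℚ.+-inverseʳ p) (ℚ.+-monoˡ-< (- p) p<q)

  +-0< : ∀ {p q} → 0ℚ < p → 0ℚ ≤ q → 0ℚ < p + q
  +-0< = ℚ.+-mono-<-≤ {0ℚ} {_} {0ℚ}

  0<con : ∀ c {{_ : Positive c}} → 0ℚ < c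
  0<con c = ℚ.positive⁻¹ c

  0≤con : ∀ c {{_ : Positive c}} → 0ℚ ≤ c
  0≤con c = ℚ.<⇒≤ (0<con c)

  0≤1 : 0ℚ ≤ 1ℚ
  0≤1 = ℚ.<⇒≤ 0<1

  ∣∣-nonneg : ∀ {x z} → 0ℚ ≤ x → x ≡ z → ∣ z ∣ ≡ x
  ∣∣-nonneg 0≤x refl = ℚ.0≤p⇒∣p∣≡p 0≤x

  -- An edge joins the vectors (a , √2 c) and (√2 b , d), and β = α/√2.
  -- Up to the common sign σ, X and √2 y are the values qα − p at its
  -- two ends; the sign says on which side of β each end lies.
  module Descent
    (Adj : (a b c d : ℚ) → Set)
    (adj-left  : ∀ {a b c d} → Adj a b c d → Adj a (a + b) c (c + c + d))
    (adj-right : ∀ {a b c d} → Adj a b c d → Adj (a + (b + b)) b (c + d) d)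
    (adj-mid   : ∀ {a b c d} → Adj a b c d →
                 Adj (a + (b + b)) (a + b) (c + d) (c + c + d))
    (β : ℚ)
    where

    record Edge (a b c d X y : ℚ) : Set where
      field
        adj  : Adj a b c d
        σ    : ℚ
        ∣σ∣≡1 : ∣ σ ∣ ≡ 1ℚ
        X≡   : X ≡ σ * ((c + c) * β - a)
        y≡   : y ≡ σ * (b - d * β)
        0≤X  : 0ℚ ≤ X
        0≤y  : 0ℚ ≤ y
        -- The relation q'x + qx' = 1 with q = √2 c, q' = d, x = X and x' = √2 y.
        unit : d * X + c * (y + y) ≡ 1ℚ

      -σ : ∣ - σ ∣ ≡ 1ℚ
      -σ = trans (ℚ.∣-p∣≡∣p∣ σ) ∣σ∣≡1

      -- The value at the odd mediant (√2 (a + b) , 2c + d), divided by √2; `2y-X≡` is the value at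
      -- the even mediant (a + 2b , √2 (c + d)). Both carry the sign -σ, which is what `mid` needs.
      X-y≡ : X - y ≡ - σ * ((a + b) - (c + c + d) * β)
      X-y≡ = trans (cong₂ _-_ X≡ y≡)
        (solve 6 (λ s a b c d β →
           s :* ((c :+ c) :* β :+ (:- a)) :+ (:- (s :* (b :+ (:- (d :* β)))))
           := (:- s) :* ((a :+ b) :+ (:- ((c :+ c :+ d) :* β)))) refl σ a b c d β)

      2y-X≡ : y + y - X ≡ - σ * (((c + d) + (c + d)) * β - (a + (b + b)))
      2y-X≡ = trans (cong₂ (λ X y → y + y - X) X≡ y≡)
        (solve 6 (λ s a b c d β →
           s :* (b :+ (:- (d :* β))) :+ s :* (b :+ (:- (d :* β)))
             :+ (:- (s :* ((c :+ c) :* β :+ (:- a))))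
           := (:- s) :* (((c :+ d) :+ (c :+ d)) :* β :+ (:- (a :+ (b :+ b))))) refl σ a b c d β)

    strip : ∀ {σ x z} → ∣ σ ∣ ≡ 1ℚ → 0ℚ ≤ x → x ≡ σ * z → ∣ z ∣ ≡ x
    strip {σ} {x} {z} ∣σ∣≡1 0≤x eq = trans (sym (ℚ.*-identityˡ ∣ z ∣))
      (trans (cong (_* ∣ z ∣) (sym ∣σ∣≡1))
      (trans (sym (ℚ.∣p*q∣≡∣p∣*∣q∣ σ z)) (∣∣-nonneg 0≤x eq)))

    -- The mediants cut the interval of an edge into three pieces, in the order even end, odd
    -- mediant, even mediant, odd end. X ≤ y places β in the first piece, 2y ≤ X in the last.
    left : ∀ {a b c d X y} → Edge a b c d X y → X ≤ y →
           Edge a (a + b) c (c + c + d) X (y - X)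
    left {a} {b} {c} {d} {X} {y} e X≤y = record
      { adj = adj-left adj ; σ = σ ; ∣σ∣≡1 = ∣σ∣≡1 ; X≡ = X≡
      ; y≡ = trans (cong₂ _-_ y≡ X≡)
          (solve 6 (λ s a b c d β →
             s :* (b :+ (:- (d :* β))) :+ (:- (s :* ((c :+ c) :* β :+ (:- a))))
             := s :* ((a :+ b) :+ (:- ((c :+ c :+ d) :* β)))) refl σ a b c d β)
      ; 0≤X = 0≤X ; 0≤y = 0≤-diff X≤y
      ; unit = trans (solve 4 (λ c d X y →
          (c :+ c :+ d) :* X :+ c :* ((y :+ (:- X)) :+ (y :+ (:- X)))
          := d :* X :+ c :* (y :+ y)) refl c d X y) unit
      }
      where open Edge e

    right : ∀ {a b c d X y} → Edge a b c d X y → y + y ≤ X →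
            Edge (a + (b + b)) b (c + d) d (X - (y + y)) y
    right {a} {b} {c} {d} {X} {y} e 2y≤X = record
      { adj = adj-right adj ; σ = σ ; ∣σ∣≡1 = ∣σ∣≡1
      ; X≡ = trans (cong₂ (λ X y → X - (y + y)) X≡ y≡)
          (solve 6 (λ s a b c d β →
             s :* ((c :+ c) :* β :+ (:- a))
               :+ (:- (s :* (b :+ (:- (d :* β))) :+ s :* (b :+ (:- (d :* β)))))
             := s :* (((c :+ d) :+ (c :+ d)) :* β :+ (:- (a :+ (b :+ b))))) refl σ a b c d β)
      ; y≡ = y≡ ; 0≤X = 0≤-diff 2y≤X ; 0≤y = 0≤y
      ; unit = trans (solve 4 (λ c d X y →
          d :* (X :+ (:- (y :+ y))) :+ (c :+ d) :* (y :+ y)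
          := d :* X :+ c :* (y :+ y)) refl c d X y) unit
      }
      where open Edge e

    -- In the middle piece the even mediant lies on the side of the old odd end, so the orientation
    -- σ is reversed.
    mid : ∀ {a b c d X y} → Edge a b c d X y → y ≤ X → X ≤ y + y →
          Edge (a + (b + b)) (a + b) (c + d) (c + c + d) (y + y - X) (X - y)
    mid {a} {b} {c} {d} {X} {y} e y≤X X≤2y = record
      { adj = adj-mid adj ; σ = - σ ; ∣σ∣≡1 = -σ ; X≡ = 2y-X≡ ; y≡ = X-y≡
      ; 0≤X = 0≤-diff X≤2y ; 0≤y = 0≤-diff y≤X
      ; unit = trans (solve 4 (λ c d X y →
          (c :+ c :+ d) :* (y :+ y :+ (:- X)) :+ (c :+ d) :* ((X :+ (:- y)) :+ (X :+ (:- y)))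
          := d :* X :+ c :* (y :+ y)) refl c d X y) unit
      }
      where open Edge e

    -- V is a rational lower approximation of √2 and h = k/N.  Replacing √2 by
    -- 2/V, the bounds √2 c ≤ N and √2 y ≤ h become 2c ≤ V N and 2y ≤ V h.
    module Search
      (V k N h : ℚ)
      (1≤V : 1ℚ ≤ V) (V≤2 : V ≤ 2ℚ) (0≤h : 0ℚ ≤ h) (1≤N : 1ℚ ≤ N) (2≤VN : 2ℚ ≤ V * N)
      (hN≡k : h * N ≡ k) (1≤k : 1ℚ ≤ k) (2≤kV² : 2ℚ ≤ k * (V * V))
      (k-bound : 2ℚ ≤ k * ((V + V) + (V + V) - 2ℚ - V * V))
      where

      data Good : Set where
        even : ∀ {a b c d} → Adj a b c d → 1ℚ ≤ c → c + c ≤ V * N →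
               ∣ (c + c) * β - a ∣ ≤ h → Good
        odd  : ∀ {a b c d} → Adj a b c d → 1ℚ ≤ d → d ≤ N →
               ∣ b - d * β ∣ + ∣ b - d * β ∣ ≤ V * h → Good

      even-or : ∀ {a b c d X} → Adj a b c d → 1ℚ ≤ c → c + c ≤ V * N →
                ∣ (c + c) * β - a ∣ ≡ X → Good ⊎ (h < X)
      even-or {X = X} adj 1≤c c≤ eq with X ≤? h
      ... | yes X≤h = inj₁ (even adj 1≤c c≤ (subst (_≤ h) (sym eq) X≤h))
      ... | no X≰h  = inj₂ (ℚ.≰⇒> X≰h)

      odd-or : ∀ {a b c d y} → Adj a b c d → 1ℚ ≤ d → d ≤ N →
               ∣ b - d * β ∣ ≡ y → Good ⊎ (V * h < y + y)
      odd-or {y = y} adj 1≤d d≤ eq with y + y ≤? V * h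
      ... | yes y≤ = inj₁ (odd adj 1≤d d≤ (subst (λ t → t + t ≤ V * h) (sym eq) y≤))
      ... | no y≰  = inj₂ (ℚ.≰⇒> y≰)

      conflict : ∀ {P Q : Set} → Good ⊎ P → Good ⊎ Q → (P → Q → ⊥) → Good
      conflict (inj₁ g) _        _ = g
      conflict (inj₂ _) (inj₁ g) _ = g
      conflict (inj₂ p) (inj₂ q) f = ⊥-elim (f p q)

      0≤V : 0ℚ ≤ V
      0≤V = ℚ.≤-trans 0≤1 1≤V

      module _ {a b c d X y} (e : Edge a b c d X y) (1≤c : 1ℚ ≤ c) (1≤d : 1ℚ ≤ d) where
        open Edge e using (unit)

        private
          0≤c = ℚ.≤-trans 0≤1 1≤c
          0<c = ℚ.<-≤-trans 0<1 1≤c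
          0<d = ℚ.<-≤-trans 0<1 1≤d
          0≤d = ℚ.<⇒≤ 0<d

          unit-0 : ∀ t → t * (d * X + c * (y + y) - 1ℚ) ≡ 0ℚ
          unit-0 t = trans (cong (λ u → t * (u - 1ℚ)) unit)
            (solve 1 (λ t → t :* (con 1ℚ :+ (:- con 1ℚ)) := con 0ℚ) refl t)

        -- The weights V − 1 and 2 − V express d + V c through the
        -- denominators 2c + d and V (c + d) of the two mediants.
        both-large : h < X → V * h < y + y → N < c + c + d → V * N < (c + d) + (c + d) → ⊥
        both-large h<X h<y N<u₁ N<u₂ = ⊥-by
          (+-0< (+-0< (+-0< (+-0<
            (*-0< (*-0< (0<con 2ℚ) 0<d) (0<-diff h<X))
            (*-0≤ (*-0≤ (0≤con 2ℚ) 0≤c) (0≤-diff (ℚ.<⇒≤ h<y))))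
            (*-0≤ (*-0≤ (*-0≤ (0≤con 2ℚ) 0≤h) (0≤-diff 1≤V)) (0≤-diff (ℚ.<⇒≤ N<u₁))))
            (*-0≤ (*-0≤ 0≤h (0≤-diff V≤2)) (0≤-diff (ℚ.<⇒≤ N<u₂))))
            (0≤-diff (subst (λ k → 2ℚ ≤ k * _) (sym hN≡k) k-bound)))
          (trans (solve 7 (λ c d X y h N V →
              con 2ℚ :* d :* (X :+ (:- h)) :+ con 2ℚ :* c :* ((y :+ y) :+ (:- (V :* h)))
              :+ con 2ℚ :* h :* (V :+ (:- con 1ℚ)) :* ((c :+ c :+ d) :+ (:- N))
              :+ h :* (con 2ℚ :+ (:- V)) :* (((c :+ d) :+ (c :+ d)) :+ (:- (V :* N)))
              :+ (h :* N :* (((V :+ V) :+ (V :+ V)) :+ (:- con 2ℚ) :+ (:- (V :* V))) :+ (:- con 2ℚ))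
              := con 2ℚ :* (d :* X :+ c :* (y :+ y) :+ (:- con 1ℚ))) refl c d X y h N V)
            (unit-0 2ℚ))

        -- The odd mediant fits, the even one does not, and β lies between
        -- the odd mediant and the odd end.
        even-large : V * h < y + y → V * h < (X - y) + (X - y) → V * N < (c + d) + (c + d) → ⊥
        even-large h<y h<u₁ N<u₂ = ⊥-by
          (+-0< (+-0< (+-0<
            (*-0< 0<d (0<-diff h<u₁))
            (*-0≤ (+-0≤ (+-0≤ 0≤c 0≤c) 0≤d) (0≤-diff (ℚ.<⇒≤ h<y))))
            (*-0≤ (*-0≤ 0≤V 0≤h) (0≤-diff (ℚ.<⇒≤ N<u₂))))
            (0≤-diff (subst (λ k → 2ℚ ≤ k * _) (sym hN≡k) 2≤kV²)))
          (trans (solve 7 (λ c d X y h N V →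
              d :* (((X :+ (:- y)) :+ (X :+ (:- y))) :+ (:- (V :* h)))
              :+ (c :+ c :+ d) :* ((y :+ y) :+ (:- (V :* h)))
              :+ V :* h :* (((c :+ d) :+ (c :+ d)) :+ (:- (V :* N)))
              :+ (h :* N :* (V :* V) :+ (:- con 2ℚ))
              := con 2ℚ :* (d :* X :+ c :* (y :+ y) :+ (:- con 1ℚ))) refl c d X y h N V)
            (unit-0 2ℚ))

        -- The mirror image of `even-large`: β lies between the even end and the even mediant, whose
        -- weighted values c (2y - X) + (c + d) X add up to 1, while both exceeding h would force a
        -- sum above h (2c + d) > h N = k ≥ 1.
        odd-large : h < X → h < y + y - X → N < c + c + d → ⊥
        odd-large h<X h<u₂ N<u₁ = ⊥-by
          (+-0< (+-0< (+-0<
            (*-0< 0<c (0<-diff h<u₂))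
            (*-0≤ (+-0≤ 0≤c 0≤d) (0≤-diff (ℚ.<⇒≤ h<X))))
            (*-0≤ 0≤h (0≤-diff (ℚ.<⇒≤ N<u₁))))
            (0≤-diff (subst (1ℚ ≤_) (sym hN≡k) 1≤k)))
          (trans (solve 6 (λ c d X y h N →
              c :* ((y :+ y :+ (:- X)) :+ (:- h))
              :+ (c :+ d) :* (X :+ (:- h))
              :+ h :* ((c :+ c :+ d) :+ (:- N))
              :+ (h :* N :+ (:- con 1ℚ))
              := con 1ℚ :* (d :* X :+ c :* (y :+ y) :+ (:- con 1ℚ))) refl c d X y h N)
            (unit-0 1ℚ))

      ≤-+ʳ : ∀ {x y} → 0ℚ ≤ y → x ≤ x + y
      ≤-+ʳ {x} {y} 0≤y = ≤-by 0≤y (solve 2 (λ x y → y := (x :+ y) :+ (:- x)) refl x y)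

      ≤-+ˡ : ∀ {x y} → 0ℚ ≤ x → y ≤ x + y
      ≤-+ˡ {x} {y} 0≤x = ≤-by 0≤x (solve 2 (λ x y → x := (x :+ y) :+ (:- y)) refl x y)

      -- The fuel is an upper bound for 2N − (c + d).
      consume : ∀ n {s s'} → s + 1ℚ ≤ s' → N + N < s + fromNat (suc n) → N + N < s' + fromNat n
      consume n {s} {s'} s+1≤s' fuel = <-by (+-0< (0<-diff fuel) (0≤-diff s+1≤s'))
        (solve 4 (λ N s s' f →
          (s :+ (con 1ℚ :+ f) :+ (:- (N :+ N))) :+ (s' :+ (:- (s :+ con 1ℚ)))
          := s' :+ f :+ (:- (N :+ N))) refl N s s' (fromNat n))

      search : ∀ n {a b c d X y} → Edge a b c d X y → 1ℚ ≤ c → 1ℚ ≤ d →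
               c + c ≤ V * N → d ≤ N → N + N < c + d + fromNat n → Good
      -- Without fuel c + d > 2N, although 2c ≤ V N ≤ 2N and d ≤ N.
      search zero {c = c} {d} e 1≤c 1≤d c≤ d≤ fuel = ⊥-elim (⊥-by
        (+-0< (+-0< (+-0<
          (*-0< (0<con 2ℚ) (0<-diff fuel))
          (0≤-diff c≤))
          (*-0≤ (0≤con 2ℚ) (0≤-diff d≤)))
          (*-0≤ (0≤-diff V≤2) (ℚ.≤-trans 0≤1 1≤N)))
        (solve 4 (λ c d N V →
          con 2ℚ :* (c :+ d :+ con 0ℚ :+ (:- (N :+ N))) :+ (V :* N :+ (:- (c :+ c)))
            :+ con 2ℚ :* (N :+ (:- d)) :+ (con 2ℚ :+ (:- V)) :* N := con 0ℚ) refl c d N V))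
      search (suc n) {a} {b} {c} {d} {X} {y} e 1≤c 1≤d c≤ d≤ fuel =
        decide (c + c + d ≤? N) ((c + d) + (c + d) ≤? V * N) (ℚ.≤-total X y) (ℚ.≤-total X (y + y))
        where
        open Edge e
        0≤c = ℚ.≤-trans 0≤1 1≤c
        0≤d = ℚ.≤-trans 0≤1 1≤d

        1≤u₁ : 1ℚ ≤ c + c + d
        1≤u₁ = ℚ.≤-trans 1≤d (≤-+ˡ (+-0≤ 0≤c 0≤c))

        1≤u₂ : 1ℚ ≤ c + d
        1≤u₂ = ℚ.≤-trans 1≤c (≤-+ʳ 0≤d)

        even-end : Good ⊎ (h < X)
        even-end = even-or adj 1≤c c≤ (strip ∣σ∣≡1 0≤X X≡)

        odd-end : Good ⊎ (V * h < y + y)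
        odd-end = odd-or adj 1≤d d≤ (strip ∣σ∣≡1 0≤y y≡)

        go-left : c + c + d ≤ N → X ≤ y → Good
        go-left u₁ X≤y = search n (left e X≤y) 1≤c 1≤u₁ c≤ u₁
          (consume n {c + d} {c + (c + c + d)} (≤-by (+-0≤ (0≤-diff 1≤c) 0≤c)
            (solve 2 (λ c d → (c :+ (:- con 1ℚ)) :+ c
              := c :+ (c :+ c :+ d) :+ (:- (c :+ d :+ con 1ℚ))) refl c d)) fuel)

        go-right : (c + d) + (c + d) ≤ V * N → y + y ≤ X → Good
        go-right u₂ 2y≤X = search n (right e 2y≤X) 1≤u₂ 1≤d u₂ d≤
          (consume n {c + d} {c + d + d} (≤-by (0≤-diff 1≤d)
            (solve 2 (λ c d → d :+ (:- con 1ℚ)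
              := (c :+ d) :+ d :+ (:- (c :+ d :+ con 1ℚ))) refl c d)) fuel)

        go-mid : c + c + d ≤ N → (c + d) + (c + d) ≤ V * N → y ≤ X → X ≤ y + y → Good
        go-mid u₁ u₂ y≤X X≤2y = search n (mid e y≤X X≤2y) 1≤u₂ 1≤u₁ u₂ u₁
          (consume n {c + d} {c + d + (c + c + d)} (≤-by (+-0≤ (+-0≤ (0≤-diff 1≤c) 0≤c) 0≤d)
            (solve 2 (λ c d → (c :+ (:- con 1ℚ)) :+ c :+ d
              := (c :+ d) :+ (c :+ c :+ d) :+ (:- (c :+ d :+ con 1ℚ))) refl c d)) fuel)

        -- The search goes on whenever a new edge around β fits below N. Otherwise the closest
        -- fitting vectors on the two sides of β cannot both be bad: the two ends if no mediant
        -- fits, or one mediant and the end of the same shape.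
        decide : Dec (c + c + d ≤ N) → Dec ((c + d) + (c + d) ≤ V * N) →
                 X ≤ y ⊎ y ≤ X → X ≤ y + y ⊎ y + y ≤ X → Good
        decide (no ¬u₁) (no ¬u₂) _ _ = conflict even-end odd-end
          λ h<X h<y → both-large e 1≤c 1≤d h<X h<y (ℚ.≰⇒> ¬u₁) (ℚ.≰⇒> ¬u₂)
        decide (yes u₁) _ (inj₁ X≤y) _ = go-left u₁ X≤y
        decide (yes u₁) (no ¬u₂) (inj₂ y≤X) _ = conflict odd-end
          (odd-or (adj-left adj) 1≤u₁ u₁ (strip -σ (0≤-diff y≤X) X-y≡))
          λ h<y h<u₁ → even-large e 1≤c 1≤d h<y h<u₁ (ℚ.≰⇒> ¬u₂)
        decide _ (yes u₂) _ (inj₂ 2y≤X) = go-right u₂ 2y≤X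
        decide (no ¬u₁) (yes u₂) _ (inj₁ X≤2y) = conflict even-end
          (even-or (adj-right adj) 1≤u₂ u₂ (strip -σ (0≤-diff X≤2y) 2y-X≡))
          λ h<X h<u₂ → odd-large e 1≤c 1≤d h<X h<u₂ (ℚ.≰⇒> ¬u₁)
        decide (yes u₁) (yes u₂) (inj₂ y≤X) (inj₁ X≤2y) = go-mid u₁ u₂ y≤X X≤2y

      -- At c = 0 the even end is ∞ and a left move is a translation that lowers y by 1. Once y ≤ 1,
      -- a right or middle move reaches c = d = 1, where `search` can begin.
      start : ∀ n {a b y} → Edge a b 0ℚ 1ℚ 1ℚ y → y ≤ fromNat n → Good
      start n {a} {b} {y} e y≤n = enter n y≤n (ℚ.≤-total 1ℚ y) (ℚ.≤-total 1ℚ (y + y))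
        where
        fuel = ℤ.∣ ↥ (N + N) ∣

        run : ∀ {a b X y} → Edge a b (0ℚ + 1ℚ) 1ℚ X y → Good
        run e = search fuel e ℚ.≤-refl ℚ.≤-refl 2≤VN 1≤N
          (ℚ.≤-<-trans (≤-fromNat (N + N))
            (<-by (0<con 2ℚ) (solve 1 (λ f →
              con 2ℚ := (con 0ℚ :+ con 1ℚ) :+ con 1ℚ :+ f :+ (:- f)) refl (fromNat fuel))))

        enter : ∀ n → y ≤ fromNat n → 1ℚ ≤ y ⊎ y ≤ 1ℚ → 1ℚ ≤ y + y ⊎ y + y ≤ 1ℚ → Good
        enter _ _ _ (inj₂ 2y≤1) = run (right e 2y≤1)
        enter _ _ (inj₂ y≤1) (inj₁ 1≤2y) = run (mid e y≤1 1≤2y)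
        enter zero y≤0 (inj₁ 1≤y) _ = ⊥-elim (ℚ.<-irrefl refl (ℚ.<-≤-trans 0<1 (ℚ.≤-trans 1≤y y≤0)))
        enter (suc n) y≤ (inj₁ 1≤y) _ = start n (left e 1≤y)
          (≤-by (0≤-diff y≤) (solve 2 (λ y f → con 1ℚ :+ f :+ (:- y)
            := f :+ (:- (y :+ (:- con 1ℚ)))) refl y (fromNat n)))

      -- The sign of the vector at ∞ and σ are chosen by the sign of β so that X = 1 and y = |β|.
      good : Adj 1ℚ 0ℚ 0ℚ 1ℚ → Adj (- 1ℚ) 0ℚ 0ℚ 1ℚ → Good
      good adj⁺ adj⁻ with ℚ.≤-total 0ℚ β
      ... | inj₁ 0≤β = start ℤ.∣ ↥ β ∣ (record
              { adj = adj⁺ ; σ = - 1ℚ ; ∣σ∣≡1 = refl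
              ; X≡ = solve 1 (λ β → con 1ℚ := (:- con 1ℚ) :* ((con 0ℚ :+ con 0ℚ) :* β :+ (:- con 1ℚ))) refl β
              ; y≡ = solve 1 (λ β → β := (:- con 1ℚ) :* (con 0ℚ :+ (:- (con 1ℚ :* β)))) refl β
              ; 0≤X = 0≤1 ; 0≤y = 0≤β
              ; unit = solve 1 (λ β → con 1ℚ :* con 1ℚ :+ con 0ℚ :* (β :+ β) := con 1ℚ) refl β })
            (≤-fromNat β)
      ... | inj₂ β≤0 = start ℤ.∣ ↥ (- β) ∣ (record
              { adj = adj⁻ ; σ = 1ℚ ; ∣σ∣≡1 = refl
              ; X≡ = solve 1 (λ β → con 1ℚ := con 1ℚ :* ((con 0ℚ :+ con 0ℚ) :* β :+ (:- (:- con 1ℚ)))) refl β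
              ; y≡ = solve 1 (λ β → :- β := con 1ℚ :* (con 0ℚ :+ (:- (con 1ℚ :* β)))) refl β
              ; 0≤X = 0≤1 ; 0≤y = ℚ.neg-antimono-≤ β≤0
              ; unit = solve 1 (λ β → con 1ℚ :* con 1ℚ :+ con 0ℚ :* ((:- β) :+ (:- β)) := con 1ℚ) refl β })
            (≤-fromNat (- β))

open import Defs
open √2-Facts using (err; approx-inv; halves-→0; halves-anti; 0≤sq)
open Rationals

-- Eventual properties, and equality of reals modulo √2² = 2.

Eventually : (ℕ → Set) → Set
Eventually P = ∃[ N ] (∀ n → N ℕ.≤ n → P n)

infixr 4 _⊗_

_⊗_ : ∀ {P Q} → Eventually P → Eventually Q → Eventually (λ n → P n × Q n)
(M , p) ⊗ (N , q) = M ℕ.⊔ N , λ n MN≤n →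
  p n (ℕ.m⊔n≤o⇒m≤o M N MN≤n) , q n (ℕ.m⊔n≤o⇒n≤o M N MN≤n)

ev-map : ∀ {P Q} → (∀ n → P n → Q n) → Eventually P → Eventually Q
ev-map f (N , p) = N , λ n N≤n → f n (p n N≤n)

instant : ∀ {P} → Eventually P → ∃[ n ] P n
instant (N , p) = N , p N ℕ.≤-refl

≡⇒∣-∣≤ : ∀ {x y ε} → 0ℚ ℚ.≤ ε → x ≡ y → ℚ.∣ x ℚ.- y ∣ ℚ.≤ ε
≡⇒∣-∣≤ {x} {ε = ε} 0≤ε refl = subst (ℚ._≤ ε) (cong ℚ.∣_∣ (sym (ℚ.+-inverseʳ x))) 0≤ε

≃-pointwise : ∀ x y → (∀ n → seq x n ≡ seq y n) → x ≃ y
≃-pointwise _ _ eq ε 0<ε = 0 , λ n _ → ≡⇒∣-∣≤ (ℚ.<⇒≤ 0<ε) (eq n)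

≃-refl : ∀ {x} → x ≃ x
≃-refl {x} = ≃-pointwise x x λ _ → refl

err-small : ∀ {δ} → 0ℚ ℚ.< δ → Eventually λ n → err (√2-approx n) ℚ.≤ δ
err-small {δ} 0<δ =
  let N , h = halves-→0 δ 0<δ
  in N , λ n N≤n → ℚ.≤-trans (proj₂ (proj₂ (approx-inv n)))
       (ℚ.≤-trans (halves-anti (ℕ.≤⇒≤′ N≤n)) h)

err-scaled-small : ∀ {B δ} → 0ℚ ℚ.≤ B → 0ℚ ℚ.< δ →
                   Eventually λ n → err (√2-approx n) ℚ.* B ℚ.≤ δ
err-scaled-small {B} {δ} 0≤B 0<δ = ev-map bound (err-small (*-0< 0<δ (recip-pos 0<1+B)))
  where
  -- Dividing δ by 1 + B instead of B admits B = 0.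
  0<1+B : 0ℚ ℚ.< 1ℚ ℚ.+ B
  0<1+B = +-0< 0<1 0≤B

  bound : ∀ n → err (√2-approx n) ℚ.≤ δ ℚ.* recip (1ℚ ℚ.+ B) → err (√2-approx n) ℚ.* B ℚ.≤ δ
  bound n e≤ = ℚ.≤-trans
    (*-mono 0≤B (ℚ.<⇒≤ (*-0< 0<δ (recip-pos 0<1+B))) e≤ ℚ.≤-refl)
    (≤-by (ℚ.<⇒≤ (*-0< 0<δ (recip-pos 0<1+B)))
      (trans (solve 3 (λ d r b → d :* r := d :* ((con 1ℚ :+ b) :* r) :+ (:- (d :* r :* b))) refl
        δ (recip (1ℚ ℚ.+ B)) B)
      (trans (cong (λ t → δ ℚ.* t ℚ.- δ ℚ.* recip (1ℚ ℚ.+ B) ℚ.* B) (recip-inverse 0<1+B))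
        (cong (ℚ._- δ ℚ.* recip (1ℚ ℚ.+ B) ℚ.* B) (ℚ.*-identityʳ δ)))))

-- err (√2-approx n) represents 2 − √2 * √2 = 0.
≃-mod : ∀ x y z → (∀ n → seq x n ℚ.- seq y n ≡ seq z n ℚ.* err (√2-approx n)) → x ≃ y
≃-mod x y z eq ε 0<ε =
  let B , 0<B , bound = bounded z
  in ev-map (close B) (bound ⊗ err-scaled-small (ℚ.<⇒≤ 0<B) 0<ε)
  where
  close : ∀ B n → ℚ.∣ seq z n ∣ ℚ.≤ B × err (√2-approx n) ℚ.* B ℚ.≤ ε →
          ℚ.∣ seq x n ℚ.- seq y n ∣ ℚ.≤ ε
  close B n (z≤B , eB≤ε) = begin
    ℚ.∣ seq x n ℚ.- seq y n ∣  ≡⟨ cong ℚ.∣_∣ (eq n) ⟩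
    ℚ.∣ seq z n ℚ.* e ∣        ≡⟨ ℚ.∣p*q∣≡∣p∣*∣q∣ (seq z n) e ⟩
    ℚ.∣ seq z n ∣ ℚ.* ℚ.∣ e ∣  ≡⟨ cong (ℚ.∣ seq z n ∣ ℚ.*_) (ℚ.0≤p⇒∣p∣≡p 0≤e) ⟩
    ℚ.∣ seq z n ∣ ℚ.* e        ≡⟨ ℚ.*-comm ℚ.∣ seq z n ∣ e ⟩
    e ℚ.* ℚ.∣ seq z n ∣        ≤⟨ ℚ.*-monoˡ-≤-nonNeg e {{ℚ.nonNegative 0≤e}} z≤B ⟩
    e ℚ.* B                    ≤⟨ eB≤ε ⟩
    ε                          ∎
    where
    open ℚ.≤-Reasoning
    e = err (√2-approx n)
    0≤e = proj₁ (proj₂ (approx-inv n))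

-- Mediants as columns of matrices in H₄.

Vector : Set
Vector = ℝ × ℝ

H : Vector → Vector → Set
H (p , q) (r , s) = H₄ ⟦ p , r ⨾ q , s ⟧

infixl 6 _⊕√2_

_⊕√2_ : Vector → Vector → Vector
(p , q) ⊕√2 (r , s) = p + √2 * r , q + √2 * s

infix 4 _≃²_

_≃²_ : Vector → Vector → Set
(p , q) ≃² (r , s) = p ≃ r × q ≃ s

H-resp : ∀ {v v' w w'} → v ≃² v' → w ≃² w' → H v w → H v' w'
H-resp (p , q) (r , s) = respects (inj₁ (p , r , q , s))

neg : Vector → Vector
neg (p , q) = - p , - q

H-rotate : ∀ {v w} → H v w → H w (neg v)
H-rotate {p , q} {r , s} h = respects
  (inj₁ (col₁ p r , col₂ p r , col₁ q s , col₂ q s)) (product h involution)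
  where
  col₁ : ∀ x y → x * 0ℝ + y * 1ℝ ≃ y
  col₁ x y = ≃-pointwise (x * 0ℝ + y * 1ℝ) y λ n →
    solve 2 (λ x y → x :* con 0ℚ :+ y :* con 1ℚ := y) refl (seq x n) (seq y n)
  col₂ : ∀ x y → x * (- 1ℝ) + y * 0ℝ ≃ - x
  col₂ x y = ≃-pointwise (x * (- 1ℝ) + y * 0ℝ) (- x) λ n →
    solve 2 (λ x y → x :* (:- con 1ℚ) :+ y :* con 0ℚ := :- x) refl (seq x n) (seq y n)

upper-mediant : ∀ {v w} → H v w → H v (w ⊕√2 v)
upper-mediant {p , q} {r , s} h = respects
  (inj₁ (col₁ p r , col₂ p r , col₁ q s , col₂ q s)) (product h translation)
  where
  col₁ : ∀ x y → x * 1ℝ + y * 0ℝ ≃ x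
  col₁ x y = ≃-pointwise (x * 1ℝ + y * 0ℝ) x λ n →
    solve 2 (λ x y → x :* con 1ℚ :+ y :* con 0ℚ := x) refl (seq x n) (seq y n)
  col₂ : ∀ x y → x * √2 + y * 1ℝ ≃ y + √2 * x
  col₂ x y = ≃-pointwise (x * √2 + y * 1ℝ) (y + √2 * x) λ n →
    solve 3 (λ x y w → x :* w :+ y :* con 1ℚ := y :+ w :* x) refl (seq x n) (seq y n) (√2-approx n)

-- Conjugation by the involution turns the inverse translation into minus the matrix with rows (1 ,
-- 0) and (√2 , 1), which adds √2 w to the first column. The sign disappears in PSL₂.
lower-mediant : ∀ {v w} → H v w → H (v ⊕√2 w) w
lower-mediant {p , q} {r , s} h = respects
  (inj₂ (col₁ p r , col₂ p r , col₁ q s , col₂ q s))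
  (product (product (product h involution) (invert translation)) involution)
  where
  rotated : ∀ x y → ℝ × ℝ
  rotated x y = x * 0ℝ + y * 1ℝ , x * (- 1ℝ) + y * 0ℝ

  col₁ : ∀ x y → let (x' , y') = rotated x y in
         (x' * 1ℝ + y' * (- 0ℝ)) * 0ℝ + (x' * (- √2) + y' * 1ℝ) * 1ℝ ≃ - (x + √2 * y)
  col₁ x y = let (x' , y') = rotated x y in ≃-pointwise
    ((x' * 1ℝ + y' * (- 0ℝ)) * 0ℝ + (x' * (- √2) + y' * 1ℝ) * 1ℝ) (- (x + √2 * y)) λ n →
    solve 3 (λ x y w →
      let x' = x :* con 0ℚ :+ y :* con 1ℚ
          y' = x :* (:- con 1ℚ) :+ y :* con 0ℚ
      in (x' :* con 1ℚ :+ y' :* (:- con 0ℚ)) :* con 0ℚ :+ (x' :* (:- w) :+ y' :* con 1ℚ) :* con 1ℚ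
         := :- (x :+ w :* y)) refl (seq x n) (seq y n) (√2-approx n)

  col₂ : ∀ x y → let (x' , y') = rotated x y in
         (x' * 1ℝ + y' * (- 0ℝ)) * (- 1ℝ) + (x' * (- √2) + y' * 1ℝ) * 0ℝ ≃ - y
  col₂ x y = let (x' , y') = rotated x y in ≃-pointwise
    ((x' * 1ℝ + y' * (- 0ℝ)) * (- 1ℝ) + (x' * (- √2) + y' * 1ℝ) * 0ℝ) (- y) λ n →
    solve 3 (λ x y w →
      let x' = x :* con 0ℚ :+ y :* con 1ℚ
          y' = x :* (:- con 1ℚ) :+ y :* con 0ℚ
      in (x' :* con 1ℚ :+ y' :* (:- con 0ℚ)) :* (:- con 1ℚ) :+ (x' :* (:- w) :+ y' :* con 1ℚ) :* con 0ℚ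
         := :- y) refl (seq x n) (seq y n) (√2-approx n)

-- Translate, rotate, translate: the second column becomes -v + √2 (w + √2 v) = v + √2 w because √2²
-- = 2.
both-mediants : ∀ {v w} → H v w → H (w ⊕√2 v) (v ⊕√2 w)
both-mediants {p , q} {r , s} h = H-resp
  (≃-refl {r + √2 * p} , ≃-refl {s + √2 * q}) (collapse p r , collapse q s)
  (upper-mediant (H-rotate (upper-mediant h)))
  where
  collapse : ∀ x y → - x + √2 * (y + √2 * x) ≃ x + √2 * y
  collapse x y = ≃-mod (- x + √2 * (y + √2 * x)) (x + √2 * y) (- x) λ n →
    solve 3 (λ x y w → ((:- x) :+ w :* (y :+ w :* x)) :+ (:- (x :+ w :* y))
      := (:- x) :* (con 2ℚ :+ (:- (w :* w)))) refl (seq x n) (seq y n) (√2-approx n)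

-- The two normal forms of p/q, with √2 in the denominator or in the numerator. The mediants of one
-- of each are again one of each.
even odd : ℚ → ℚ → Vector
even a c = fromℚ a , √2 * fromℚ c
odd  b d = √2 * fromℚ b , fromℚ d

odd-mediant : ∀ a b c d → odd b d ⊕√2 even a c ≃² odd (a ℚ.+ b) (c ℚ.+ c ℚ.+ d)
odd-mediant a b c d =
  ≃-pointwise (√2 * fromℚ b + √2 * fromℚ a) (√2 * fromℚ (a ℚ.+ b)) (λ n →
    solve 3 (λ a b w → w :* b :+ w :* a := w :* (a :+ b)) refl a b (√2-approx n)) ,
  ≃-mod (fromℚ d + √2 * (√2 * fromℚ c)) (fromℚ (c ℚ.+ c ℚ.+ d)) (fromℚ (ℚ.- c)) (λ n →
    solve 3 (λ c d w → (d :+ w :* (w :* c)) :+ (:- (c :+ c :+ d))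
      := (:- c) :* (con 2ℚ :+ (:- (w :* w)))) refl c d (√2-approx n))

even-mediant : ∀ a b c d → even a c ⊕√2 odd b d ≃² even (a ℚ.+ (b ℚ.+ b)) (c ℚ.+ d)
even-mediant a b c d =
  ≃-mod (fromℚ a + √2 * (√2 * fromℚ b)) (fromℚ (a ℚ.+ (b ℚ.+ b))) (fromℚ (ℚ.- b)) (λ n →
    solve 3 (λ a b w → (a :+ w :* (w :* b)) :+ (:- (a :+ (b :+ b)))
      := (:- b) :* (con 2ℚ :+ (:- (w :* w)))) refl a b (√2-approx n)) ,
  ≃-pointwise (√2 * fromℚ c + √2 * fromℚ d) (√2 * fromℚ (c ℚ.+ d)) (λ n →
    solve 3 (λ c d w → w :* c :+ w :* d := w :* (c :+ d)) refl c d (√2-approx n))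

≃²-refl : ∀ {v} → v ≃² v
≃²-refl {p , q} = ≃-refl {p} , ≃-refl {q}

-- Both column orders are allowed, since `adj-mid` exchanges them.
Adj : (a b c d : ℚ) → Set
Adj a b c d = H (even a c) (odd b d) ⊎ H (odd b d) (even a c)

adj-left : ∀ {a b c d} → Adj a b c d → Adj a (a ℚ.+ b) c (c ℚ.+ c ℚ.+ d)
adj-left {a} {b} {c} {d} = Sum.map
  (λ h → H-resp (≃²-refl {even a c}) (odd-mediant a b c d) (upper-mediant h))
  (λ h → H-resp (odd-mediant a b c d) (≃²-refl {even a c}) (lower-mediant h))

adj-right : ∀ {a b c d} → Adj a b c d → Adj (a ℚ.+ (b ℚ.+ b)) b (c ℚ.+ d) d
adj-right {a} {b} {c} {d} = Sum.map
  (λ h → H-resp (even-mediant a b c d) (≃²-refl {odd b d}) (lower-mediant h))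
  (λ h → H-resp (≃²-refl {odd b d}) (even-mediant a b c d) (upper-mediant h))

adj-mid : ∀ {a b c d} → Adj a b c d →
          Adj (a ℚ.+ (b ℚ.+ b)) (a ℚ.+ b) (c ℚ.+ d) (c ℚ.+ c ℚ.+ d)
adj-mid {a} {b} {c} {d} = swap ∘ Sum.map
  (λ h → H-resp (odd-mediant a b c d) (even-mediant a b c d) (both-mediants h))
  (λ h → H-resp (even-mediant a b c d) (odd-mediant a b c d) (both-mediants h))

0≃√2*0 : 0ℝ ≃ √2 * 0ℝ
0≃√2*0 = ≃-pointwise 0ℝ (√2 * 0ℝ) λ n → sym (ℚ.*-zeroʳ (√2-approx n))

adj⁺ : Adj 1ℚ 0ℚ 0ℚ 1ℚ
adj⁺ = inj₁ (H-resp (≃-refl {1ℝ} , 0≃√2*0) (0≃√2*0 , ≃-refl {1ℝ}) unit)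

adj⁻ : Adj (ℚ.- 1ℚ) 0ℚ 0ℚ 1ℚ
adj⁻ = inj₂ (H-resp (0≃√2*0 , ≃-refl {1ℝ})
  (≃-pointwise (- 1ℝ) (fromℚ (ℚ.- 1ℚ)) (λ _ → refl) , 0≃√2*0) involution)

even-normalized : ∀ {a b c d} → Adj a b c d → 1ℚ ℚ.≤ c → Normalized (fromℚ a) (√2 * fromℚ c)
even-normalized {c = c} adj 1≤c = from adj
  where
  positive' : 0ℝ < √2 * fromℚ c
  positive' = 1ℚ , 0<1 , 0 , λ n _ → *-mono {1ℚ} 0≤1 (ℚ.≤-trans 0≤1 (proj₁ (approx-inv n)))
    (proj₁ (approx-inv n)) 1≤c

  from : Adj _ _ c _ → Normalized _ _
  from (inj₁ h) = normalized _ _ h positive'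
  from (inj₂ h) = normalized _ _ (H-rotate h) positive'

odd-normalized : ∀ {a b c d} → Adj a b c d → 1ℚ ℚ.≤ d → Normalized (√2 * fromℚ b) (fromℚ d)
odd-normalized {d = d} adj 1≤d = from adj
  where
  positive' : 0ℝ < fromℚ d
  positive' = 1ℚ , 0<1 , 0 , λ _ _ → 1≤d

  from : Adj _ _ _ d → Normalized _ _
  from (inj₁ h) = normalized _ _ (H-rotate h) positive'
  from (inj₂ h) = normalized _ _ h positive'

-- Bounds for the approximations of √2 and the constants of the search.

1≤√2 : ∀ n → 1ℚ ℚ.≤ √2-approx n
1≤√2 n = proj₁ (approx-inv n)

0≤√2 : ∀ n → 0ℚ ℚ.≤ √2-approx n
0≤√2 n = ℚ.≤-trans 0≤1 (1≤√2 n)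

0≤err : ∀ n → 0ℚ ℚ.≤ err (√2-approx n)
0≤err n = proj₁ (proj₂ (approx-inv n))

√2≤3/2 : ∀ i → √2-approx i ℚ.≤ + 3 ℚ./ 2
√2≤3/2 i = ≤-by (*-0≤ (0≤con (+ 1 ℚ./ 3)) (+-0≤ (+-0≤ (0≤err i) (0≤con (+ 1 ℚ./ 4))) (0≤sq (√2-approx i ℚ.- + 3 ℚ./ 2))))
  (solve 1 (λ w → con (+ 1 ℚ./ 3) :* ((con 2ℚ :+ (:- (w :* w))) :+ con (+ 1 ℚ./ 4)
      :+ (w :+ (:- con (+ 3 ℚ./ 2))) :* (w :+ (:- con (+ 3 ℚ./ 2))))
    := con (+ 3 ℚ./ 2) :+ (:- w)) refl (√2-approx i))

-- With V standing for √2 and e for 2 − V²: the inequalities on which the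
-- search rests hold with equality or better for k = (V + 1)/2, up to O(e).
module Constants
  {V k ε : ℚ} (1≤V : 1ℚ ℚ.≤ V) (0≤e : 0ℚ ℚ.≤ err V)
  (e≤⅛ : err V ℚ.≤ + 1 ℚ./ 8) (2e≤ε : err V ℚ.+ err V ℚ.≤ ε)
  (0≤ε : 0ℚ ℚ.≤ ε) (κ+ε≤k : (V ℚ.+ 1ℚ) ℚ.* ½ ℚ.+ ε ℚ.≤ k)
  where

  private
    0≤V : 0ℚ ℚ.≤ V
    0≤V = ℚ.≤-trans 0≤1 1≤V

  V≤2 : V ℚ.≤ 2ℚ
  V≤2 = ≤-by (+-0≤ 0≤e (*-0≤ 0≤V (0≤-diff 1≤V)))
    (solve 1 (λ v → (con 2ℚ :+ (:- (v :* v))) :+ v :* (v :+ (:- con 1ℚ)) := con 2ℚ :+ (:- v)) refl V)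

  5/4≤V : + 5 ℚ./ 4 ℚ.≤ V
  5/4≤V = ≤-by (*-0≤ (0≤con (+ 1 ℚ./ 3))
      (+-0≤ (+-0≤ (*-0≤ (0≤-diff V≤2) (0≤-diff 1≤V)) (0≤-diff e≤⅛)) (0≤con (+ 1 ℚ./ 8))))
    (solve 1 (λ v → con (+ 1 ℚ./ 3) :* ((con 2ℚ :+ (:- v)) :* (v :+ (:- con 1ℚ))
        :+ (con (+ 1 ℚ./ 8) :+ (:- (con 2ℚ :+ (:- (v :* v))))) :+ con (+ 1 ℚ./ 8))
      := v :+ (:- con (+ 5 ℚ./ 4))) refl V)

  9/8≤k : + 9 ℚ./ 8 ℚ.≤ k
  9/8≤k = ≤-by (+-0≤ (+-0≤ (0≤-diff κ+ε≤k) (*-0≤ (0≤con ½) (0≤-diff 5/4≤V))) 0≤ε)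
    (solve 3 (λ v k ε → k :+ (:- ((v :+ con 1ℚ) :* con ½ :+ ε))
        :+ con ½ :* (v :+ (:- con (+ 5 ℚ./ 4))) :+ ε
      := k :+ (:- con (+ 9 ℚ./ 8))) refl V k ε)

  1≤k : 1ℚ ℚ.≤ k
  1≤k = ℚ.≤-trans (toWitness {a? = 1ℚ ℚ.≤? + 9 ℚ./ 8} _) 9/8≤k

  2≤kV² : 2ℚ ℚ.≤ k ℚ.* (V ℚ.* V)
  2≤kV² = ≤-by (+-0≤ (+-0≤
      (*-0≤ (0≤-diff 9/8≤k) (0≤sq V))
      (*-0≤ (0≤con (+ 9 ℚ./ 8)) (0≤-diff e≤⅛)))
      (0≤con (+ 7 ℚ./ 64)))
    (solve 2 (λ v k → (k :+ (:- con (+ 9 ℚ./ 8))) :* (v :* v)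
        :+ con (+ 9 ℚ./ 8) :* (con (+ 1 ℚ./ 8) :+ (:- (con 2ℚ :+ (:- (v :* v)))))
        :+ con (+ 7 ℚ./ 64)
      := k :* (v :* v) :+ (:- con 2ℚ)) refl V k)

  -- The factor equals 4 (V - 1) + e with e = 2 - V². At k = (V + 1)/2 the product is at least 2 -
  -- 2e, and the extra ε in k adds at least ε ≥ 2e because V ≥ 5/4.
  k-bound : 2ℚ ℚ.≤ k ℚ.* ((V ℚ.+ V) ℚ.+ (V ℚ.+ V) ℚ.- 2ℚ ℚ.- V ℚ.* V)
  k-bound = ≤-by (+-0≤ (+-0≤ (+-0≤ (+-0≤
      (*-0≤ (0≤-diff κ+ε≤k) (+-0≤ (*-0≤ (0≤con (+ 4 ℚ./ 1)) (0≤-diff 1≤V)) 0≤e))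
      (0≤-diff 2e≤ε))
      (*-0≤ 0≤e (*-0≤ (+-0≤ 0≤V 0≤1) (0≤con ½))))
      (*-0≤ (*-0≤ (0≤con (+ 4 ℚ./ 1)) 0≤ε) (0≤-diff 5/4≤V)))
      (*-0≤ 0≤ε 0≤e))
    (solve 3 (λ v k ε → let e = con 2ℚ :+ (:- (v :* v)) in
        (k :+ (:- ((v :+ con 1ℚ) :* con ½ :+ ε))) :* (con (+ 4 ℚ./ 1) :* (v :+ (:- con 1ℚ)) :+ e)
        :+ (ε :+ (:- (e :+ e))) :+ e :* ((v :+ con 1ℚ) :* con ½)
        :+ con (+ 4 ℚ./ 1) :* ε :* (v :+ (:- con (+ 5 ℚ./ 4))) :+ ε :* e
      := k :* ((v :+ v) :+ (v :+ v) :+ (:- con 2ℚ) :+ (:- (v :* v))) :+ (:- con 2ℚ)) refl V k ε)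

-- Rational substitutes for α and √2.

approximate : ∀ x {δ} → 0ℚ ℚ.< δ → ∃[ q ] Eventually λ n → ℚ.∣ seq x n ℚ.- q ∣ ℚ.≤ δ
approximate x {δ} 0<δ =
  let N , h = cauchy x δ 0<δ in seq x N , N , λ n N≤n → h n N N≤n ℕ.≤-refl

∣∣-lower : ∀ {x q δ} → ℚ.∣ x ℚ.- q ∣ ℚ.≤ δ → q ℚ.- δ ℚ.≤ x
∣∣-lower {x} {q} {δ} h = ≤-by (0≤-diff (ℚ.≤-trans
    (ℚ.≤-trans (p≤∣p∣ (q ℚ.- x)) (ℚ.≤-reflexive (∣p-q∣≡∣q-p∣ q x))) h))
  (solve 3 (λ x q δ → δ :+ (:- (q :+ (:- x))) := x :+ (:- (q :+ (:- δ)))) refl x q δ)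

∣∣-upper : ∀ {x q δ} → ℚ.∣ x ℚ.- q ∣ ℚ.≤ δ → x ℚ.≤ q ℚ.+ δ
∣∣-upper {x} {q} {δ} h = ≤-by (0≤-diff (ℚ.≤-trans (p≤∣p∣ (x ℚ.- q)) h))
  (solve 3 (λ x q δ → δ :+ (:- (x :+ (:- q))) := (q :+ δ) :+ (:- x)) refl x q δ)

∣u*v∣≤ : ∀ {u v a b} → ℚ.∣ u ∣ ℚ.≤ a → ℚ.∣ v ∣ ℚ.≤ b → ℚ.∣ u ℚ.* v ∣ ℚ.≤ a ℚ.* b
∣u*v∣≤ {u} {v} {a} {b} hu hv = subst (ℚ._≤ a ℚ.* b) (sym (ℚ.∣p*q∣≡∣p∣*∣q∣ u v))
  (*-mono (ℚ.0≤∣p∣ v) (ℚ.≤-trans (ℚ.0≤∣p∣ u) hu) hu hv)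

∣u+v∣≤ : ∀ {u v a b} → ℚ.∣ u ∣ ℚ.≤ a → ℚ.∣ v ∣ ℚ.≤ b → ℚ.∣ u ℚ.+ v ∣ ℚ.≤ a ℚ.+ b
∣u+v∣≤ {u} {v} hu hv = ℚ.≤-trans (ℚ.∣p+q∣≤∣p∣+∣q∣ u v) (ℚ.+-mono-≤ hu hv)

∣nonneg∣≤ : ∀ {u a} → 0ℚ ℚ.≤ u → u ℚ.≤ a → ℚ.∣ u ∣ ℚ.≤ a
∣nonneg∣≤ 0≤u u≤a = subst (ℚ._≤ _) (sym (ℚ.0≤p⇒∣p∣≡p 0≤u)) u≤a

-- As α/√2 = α √2 / 2, half of a rational approximation γ of α √2 serves as β. The error splits into
-- (2 - √2²) α / 2 and √2 (α √2 - γ) / 2.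
√2-quotient : ∀ α {θ} → 0ℚ ℚ.< θ →
              ∃[ β ] Eventually λ n → ℚ.∣ seq α n ℚ.- √2-approx n ℚ.* β ∣ ℚ.≤ θ
√2-quotient α {θ} 0<θ =
  let γ , γ-close = approximate (α * √2) (half-pos 0<θ)
      B , 0<B , bound = bounded α
  in ½ ℚ.* γ , ev-map (λ n (a , b , c) → close n γ B a b c)
       (γ-close ⊗ bound ⊗ err-scaled-small (ℚ.<⇒≤ 0<B) 0<θ)
  where
  close : ∀ n γ B → ℚ.∣ seq α n ℚ.* √2-approx n ℚ.- γ ∣ ℚ.≤ ½ ℚ.* θ → ℚ.∣ seq α n ∣ ℚ.≤ B →
          err (√2-approx n) ℚ.* B ℚ.≤ θ → ℚ.∣ seq α n ℚ.- √2-approx n ℚ.* (½ ℚ.* γ) ∣ ℚ.≤ θ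
  close n γ B hγ hB he = begin
    ℚ.∣ a ℚ.- w ℚ.* (½ ℚ.* γ) ∣
      ≡⟨ cong ℚ.∣_∣ (solve 3 (λ a w γ → a :+ (:- (w :* (con ½ :* γ)))
           := con ½ :* ((con 2ℚ :+ (:- (w :* w))) :* a) :+ con ½ :* (w :* (a :* w :+ (:- γ)))) refl a w γ) ⟩
    ℚ.∣ ½ ℚ.* (err w ℚ.* a) ℚ.+ ½ ℚ.* (w ℚ.* (a ℚ.* w ℚ.- γ)) ∣
      ≤⟨ ∣u+v∣≤ (∣u*v∣≤ {½} ℚ.≤-refl (∣u*v∣≤ (∣nonneg∣≤ (0≤err n) ℚ.≤-refl) hB))
           (∣u*v∣≤ {½} ℚ.≤-refl (∣u*v∣≤ (∣nonneg∣≤ (0≤√2 n) w≤2) hγ)) ⟩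
    ½ ℚ.* (err w ℚ.* B) ℚ.+ ½ ℚ.* (2ℚ ℚ.* (½ ℚ.* θ))
      ≤⟨ ℚ.+-monoˡ-≤ _ (ℚ.*-monoˡ-≤-nonNeg ½ he) ⟩
    ½ ℚ.* θ ℚ.+ ½ ℚ.* (2ℚ ℚ.* (½ ℚ.* θ))
      ≡⟨ solve 1 (λ t → con ½ :* t :+ con ½ :* (con 2ℚ :* (con ½ :* t)) := t) refl θ ⟩
    θ ∎
    where
    open ℚ.≤-Reasoning
    a = seq α n
    w = √2-approx n

    w≤2 : w ℚ.≤ 2ℚ
    w≤2 = ℚ.≤-trans (√2≤3/2 n) (toWitness {a? = + 3 ℚ./ 2 ℚ.≤? 2ℚ} _)

-- Twice the product is at most the sum of the squares, and both approximations have square at most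
-- 2. Hence every approximation of √2 is at most 2/V, which lets `√2*-≤` recover real bounds from
-- those of the search.
√2*V≤2 : ∀ n {V} → 0ℚ ℚ.≤ err V → √2-approx n ℚ.* V ℚ.≤ 2ℚ
√2*V≤2 n {V} 0≤e = ≤-by
  (*-0≤ (0≤con ½) (+-0≤ (+-0≤ (0≤err n) 0≤e) (0≤sq (√2-approx n ℚ.- V))))
  (solve 2 (λ w v → con ½ :* ((con 2ℚ :+ (:- (w :* w))) :+ (con 2ℚ :+ (:- (v :* v)))
      :+ (w :+ (:- v)) :* (w :+ (:- v)))
    := con 2ℚ :+ (:- (w :* v))) refl (√2-approx n) V)

√2*-≤ : ∀ n {V x t} → 0ℚ ℚ.≤ err V → 0ℚ ℚ.≤ t → x ℚ.+ x ℚ.≤ V ℚ.* t → √2-approx n ℚ.* x ℚ.≤ t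
√2*-≤ n {V} {x} {t} 0≤e 0≤t h = ≤-by
  (*-0≤ (0≤con ½) (+-0≤ (*-0≤ (0≤√2 n) (0≤-diff h)) (*-0≤ (0≤-diff (√2*V≤2 n {V} 0≤e)) 0≤t)))
  (solve 4 (λ w v x t → con ½ :* (w :* (v :* t :+ (:- (x :+ x))) :+ (con 2ℚ :+ (:- (w :* v))) :* t)
    := t :+ (:- (w :* x))) refl (√2-approx n) V x t)

-- The upper bound K(α) ≤ κ.

κ : ℝ
κ = (√2 + 1ℝ) / 2ℝ [ 0<2 ]

module Upper (α : ℝ) (s' s : ℚ) (κ<s' : κ < fromℚ s') (s'<s : s' ℚ.< s) where

  ε = proj₁ κ<s'
  0<ε = proj₁ (proj₂ κ<s')

  -- One index supplies V: there κ < s' shows with margin ε, and 2 - V² is small against both ⅛ and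
  -- ε.
  sampled : ∃[ n ] (seq κ n ℚ.+ ε ℚ.≤ s' × err (√2-approx n) ℚ.≤ + 1 ℚ./ 8 ×
                    err (√2-approx n) ℚ.≤ ½ ℚ.* ε)
  sampled = instant (proj₂ (proj₂ κ<s') ⊗ err-small (0<con (+ 1 ℚ./ 8)) ⊗ err-small (half-pos 0<ε))

  m = proj₁ sampled
  V = √2-approx m
  κ+ε≤s' = proj₁ (proj₂ sampled)
  e≤⅛ = proj₁ (proj₂ (proj₂ sampled))
  e≤½ε = proj₂ (proj₂ (proj₂ sampled))

  open Constants {V} {s'} {ε} (1≤√2 m) (0≤err m) e≤⅛
    (ℚ.≤-trans (ℚ.+-mono-≤ e≤½ε e≤½ε) (ℚ.≤-reflexive (half+half ε))) (ℚ.<⇒≤ 0<ε) κ+ε≤s'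

  -- The search runs with s'. Half of D pays for replacing M by N, the other half for replacing α by
  -- √2 β.
  D = s ℚ.- s'
  0<D = 0<-diff s'<s
  0<s' = ℚ.<-≤-trans 0<1 1≤k
  0≤s' = ℚ.<⇒≤ 0<s'
  0<s = ℚ.<-trans 0<s' s'<s

  module _ (M : ℝ) (3≤M : fromℚ (+ 3 ℚ./ 1) ≤ M) (0<M : 0ℝ < M) where

    ¼ = + 1 ℚ./ 4
    -- Eventually N ≤ M ≤ N + 2η, and 2ηs = D/2.
    η = ¼ ℚ.* (D ℚ.* recip s)

    0<η : 0ℚ ℚ.< η
    0<η = *-0< (0<con ¼) (*-0< 0<D (recip-pos 0<s))

    M-approx = approximate M 0<η
    q = proj₁ M-approx
    N = q ℚ.- η

    η≤¼ : η ℚ.≤ ¼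
    η≤¼ = ≤-by (*-0≤ (0≤con ¼) (*-0≤ 0≤s' (ℚ.<⇒≤ (recip-pos 0<s))))
      (trans (solve 3 (λ s s' r → con ¼ :* (s' :* r)
          := con ¼ :* (s :* r) :+ (:- (con ¼ :* ((s :+ (:- s')) :* r)))) refl s s' (recip s))
        (cong (λ t → ¼ ℚ.* t ℚ.- η) (recip-inverse 0<s)))

    N≤M : Eventually λ n → N ℚ.≤ seq M n
    N≤M = ev-map (λ n → ∣∣-lower) (proj₂ M-approx)

    M≤N+2η : Eventually λ n → seq M n ℚ.≤ N ℚ.+ (η ℚ.+ η)
    M≤N+2η = ev-map (λ n h → ℚ.≤-trans (∣∣-upper h) (ℚ.≤-reflexive
      (solve 2 (λ q η → q :+ η := q :+ (:- η) :+ (η :+ η)) refl q η))) (proj₂ M-approx)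

    2≤N : 2ℚ ℚ.≤ N
    2≤N = let n , M≤ , 3≤ = instant (M≤N+2η ⊗ 3≤M ½ 0<½) in
      ≤-by (+-0≤ (+-0≤ (0≤-diff M≤) (0≤-diff 3≤)) (+-0≤ (0≤-diff η≤¼) (0≤-diff η≤¼)))
        (solve 3 (λ N M η → (N :+ (η :+ η) :+ (:- M)) :+ (M :+ con ½ :+ (:- con (+ 3 ℚ./ 1)))
            :+ ((con ¼ :+ (:- η)) :+ (con ¼ :+ (:- η))) := N :+ (:- con 2ℚ)) refl N (seq M n) η)

    1≤N : 1ℚ ℚ.≤ N
    1≤N = ℚ.≤-trans (toWitness {a? = 1ℚ ℚ.≤? 2ℚ} _) 2≤N

    0<N = ℚ.<-≤-trans 0<1 1≤N
    0≤N = ℚ.<⇒≤ 0<N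

    h = s' ℚ.* recip N

    0≤h : 0ℚ ℚ.≤ h
    0≤h = *-0≤ 0≤s' (ℚ.<⇒≤ (recip-pos 0<N))

    hN≡s' : h ℚ.* N ≡ s'
    hN≡s' = trans (solve 3 (λ s r N → s :* r :* N := s :* (N :* r)) refl s' (recip N) N)
      (trans (cong (s' ℚ.*_) (recip-inverse 0<N)) (ℚ.*-identityʳ s'))

    -- The factor N + 2 counts copies of θ: N from multiplying α - √2 β by q ≤ N, one for √2² - 2,
    -- one as the margin of the strict inequality. The factor N + 1 eventually bounds M.
    area = (N ℚ.+ 1ℚ) ℚ.* (N ℚ.+ 2ℚ)
    θ = ½ ℚ.* D ℚ.* recip area

    0<area : 0ℚ ℚ.< area
    0<area = *-0< (+-0< 0<N 0≤1) (+-0< 0<N (0≤con 2ℚ))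

    0<θ : 0ℚ ℚ.< θ
    0<θ = *-0< (half-pos 0<D) (recip-pos 0<area)

    0≤θ = ℚ.<⇒≤ 0<θ

    θ-area : area ℚ.* θ ≡ ½ ℚ.* D
    θ-area = trans (solve 3 (λ a d r → a :* (con ½ :* d :* r) := con ½ :* d :* (a :* r)) refl area D (recip area))
      (trans (cong (½ ℚ.* D ℚ.*_) (recip-inverse 0<area)) (ℚ.*-identityʳ (½ ℚ.* D)))

    β-approx = √2-quotient α 0<θ
    β = proj₁ β-approx

    open Descent Adj adj-left adj-right adj-mid β
    open Search V s' N h (1≤√2 m) V≤2 0≤h 1≤N
      (ℚ.≤-trans 2≤N (≤-by (*-0≤ (0≤-diff (1≤√2 m)) 0≤N)
        (solve 2 (λ v n → (v :+ (:- con 1ℚ)) :* n := v :* n :+ (:- n)) refl V N)))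
      hN≡s' 1≤k 2≤kV² k-bound hiding (even; odd)

    -- h (N + 2η) + (N + 1)(N + 2) θ ≤ s' + D/2 + D/2
    fits : ∀ n {v} → v ℚ.≤ h ℚ.+ N ℚ.* θ ℚ.+ θ → N ℚ.≤ seq M n → seq M n ℚ.≤ N ℚ.+ (η ℚ.+ η) →
           v ℚ.+ θ ℚ.≤ s ℚ.* recip (seq M n)
    fits n {v} v≤ N≤ ≤N = begin
      v ℚ.+ θ
        ≡⟨ trans (cong ((v ℚ.+ θ) ℚ.*_) (recip-inverse 0<Mₙ)) (ℚ.*-identityʳ _) ⟨
      (v ℚ.+ θ) ℚ.* (Mₙ ℚ.* r)
        ≡⟨ ℚ.*-assoc (v ℚ.+ θ) Mₙ r ⟨
      (v ℚ.+ θ) ℚ.* Mₙ ℚ.* r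
        ≤⟨ ℚ.*-monoʳ-≤-nonNeg r {{ℚ.nonNegative (ℚ.<⇒≤ (recip-pos 0<Mₙ))}} total ⟩
      s ℚ.* r ∎
      where
      open ℚ.≤-Reasoning
      Mₙ = seq M n
      r = recip Mₙ
      0<Mₙ = ℚ.<-≤-trans 0<N N≤

      h≤s' : h ℚ.≤ s'
      h≤s' = subst (h ℚ.≤_) hN≡s' (≤-by (*-0≤ 0≤h (0≤-diff 1≤N))
        (solve 2 (λ h n → h :* (n :+ (:- con 1ℚ)) := h :* n :+ (:- h)) refl h N))

      2ηs≡ : (η ℚ.+ η) ℚ.* s ≡ ½ ℚ.* D
      2ηs≡ = trans (solve 3 (λ d r s → (con ¼ :* (d :* r) :+ con ¼ :* (d :* r)) :* s
          := con ½ :* d :* (s :* r)) refl D (recip s) s)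
        (trans (cong (½ ℚ.* D ℚ.*_) (recip-inverse 0<s)) (ℚ.*-identityʳ (½ ℚ.* D)))

      Z = h ℚ.+ N ℚ.* θ ℚ.+ θ ℚ.+ θ

      0≤Z : 0ℚ ℚ.≤ Z
      0≤Z = +-0≤ (+-0≤ (+-0≤ 0≤h (*-0≤ 0≤N 0≤θ)) 0≤θ) 0≤θ

      total : (v ℚ.+ θ) ℚ.* Mₙ ℚ.≤ s
      total = begin
        (v ℚ.+ θ) ℚ.* Mₙ
          ≤⟨ *-mono (ℚ.<⇒≤ 0<Mₙ) 0≤Z (ℚ.+-monoˡ-≤ θ v≤) ≤N ⟩
        Z ℚ.* (N ℚ.+ (η ℚ.+ η))
          ≤⟨ ≤-by (+-0≤ (+-0≤ (*-0≤ (*-0≤ (+-0≤ 0≤N (0≤con 2ℚ)) 0≤θ) (+-0≤ (0≤-diff η≤¼) (0≤-diff η≤¼)))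
                 (*-0≤ (*-0≤ (+-0≤ 0≤N (0≤con 2ℚ)) 0≤θ) (0≤con ½)))
                 (*-0≤ (+-0≤ (0≤-diff h≤s') (ℚ.<⇒≤ 0<D)) (+-0≤ (ℚ.<⇒≤ 0<η) (ℚ.<⇒≤ 0<η))))
               (solve 6 (λ h N θ η s s' →
                  (N :+ con 2ℚ) :* θ :* ((con ¼ :+ (:- η)) :+ (con ¼ :+ (:- η)))
                  :+ (N :+ con 2ℚ) :* θ :* con ½
                  :+ ((s' :+ (:- h)) :+ (s :+ (:- s'))) :* (η :+ η)
                  := (h :* N :+ (η :+ η) :* s :+ (N :+ con 1ℚ) :* (N :+ con 2ℚ) :* θ)
                     :+ (:- ((h :+ N :* θ :+ θ :+ θ) :* (N :+ (η :+ η))))) refl h N θ η s s') ⟩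
        h ℚ.* N ℚ.+ (η ℚ.+ η) ℚ.* s ℚ.+ area ℚ.* θ
          ≡⟨ cong₂ ℚ._+_ (cong₂ ℚ._+_ hN≡s' 2ηs≡) θ-area ⟩
        s' ℚ.+ ½ ℚ.* D ℚ.+ ½ ℚ.* D
          ≡⟨ solve 2 (λ s s' → s' :+ con ½ :* (s :+ (:- s')) :+ con ½ :* (s :+ (:- s')) := s) refl s s' ⟩
        s ∎

    Solution : Set
    Solution = ∃[ p ] ∃[ q ] (Normalized p q ×
      ∣ q * α - p ∣ < fromℚ s / M [ 0<M ] × 1ℝ ≤ q × q ≤ M)

    -- |√2 c α − a| ≤ |2cβ − a| + √2 c |α − √2 β| + |(√2² − 2) c β|
    even-value : ∀ n {a c} → 1ℚ ℚ.≤ c → √2-approx n ℚ.* c ℚ.≤ N →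
                 ℚ.∣ (c ℚ.+ c) ℚ.* β ℚ.- a ∣ ℚ.≤ h →
                 ℚ.∣ seq α n ℚ.- √2-approx n ℚ.* β ∣ ℚ.≤ θ →
                 err (√2-approx n) ℚ.* ℚ.∣ c ℚ.* β ∣ ℚ.≤ θ →
                 ℚ.∣ √2-approx n ℚ.* c ℚ.* seq α n ℚ.- a ∣ ℚ.≤ h ℚ.+ N ℚ.* θ ℚ.+ θ
    even-value n {a} {c} 1≤c wc≤N X≤h α≈ e≤θ = subst (ℚ._≤ h ℚ.+ N ℚ.* θ ℚ.+ θ)
      (cong ℚ.∣_∣ (solve 5 (λ w c x a β →
          ((c :+ c) :* β :+ (:- a)) :+ w :* c :* (x :+ (:- (w :* β)))
            :+ (con 2ℚ :+ (:- (w :* w))) :* (:- (c :* β))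
          := w :* c :* x :+ (:- a)) refl (√2-approx n) c (seq α n) a β))
      (∣u+v∣≤ (∣u+v∣≤ X≤h
          (∣u*v∣≤ (∣nonneg∣≤ (*-0≤ (0≤√2 n) (ℚ.≤-trans 0≤1 1≤c)) wc≤N) α≈))
        (ℚ.≤-trans (∣u*v∣≤ (∣nonneg∣≤ (0≤err n) ℚ.≤-refl)
            (ℚ.≤-reflexive (ℚ.∣-p∣≡∣p∣ (c ℚ.* β)))) e≤θ))

    odd-value : ∀ n {b d} → 1ℚ ℚ.≤ d → d ℚ.≤ N →
                ℚ.∣ b ℚ.- d ℚ.* β ∣ ℚ.+ ℚ.∣ b ℚ.- d ℚ.* β ∣ ℚ.≤ V ℚ.* h →
                ℚ.∣ seq α n ℚ.- √2-approx n ℚ.* β ∣ ℚ.≤ θ →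
                ℚ.∣ d ℚ.* seq α n ℚ.- √2-approx n ℚ.* b ∣ ℚ.≤ h ℚ.+ N ℚ.* θ ℚ.+ θ
    odd-value n {b} {d} 1≤d d≤N y≤ α≈ = ℚ.≤-trans (subst (ℚ._≤ h ℚ.+ N ℚ.* θ)
      (cong ℚ.∣_∣ (solve 5 (λ w d x b β →
          w :* (:- (b :+ (:- (d :* β)))) :+ d :* (x :+ (:- (w :* β)))
          := d :* x :+ (:- (w :* b))) refl (√2-approx n) d (seq α n) b β))
      (∣u+v∣≤
        (ℚ.≤-trans (∣u*v∣≤ (∣nonneg∣≤ (0≤√2 n) ℚ.≤-refl) (ℚ.≤-reflexive (ℚ.∣-p∣≡∣p∣ (b ℚ.- d ℚ.* β))))
          (√2*-≤ n {V} (0≤err m) 0≤h y≤))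
        (∣u*v∣≤ (∣nonneg∣≤ (ℚ.≤-trans 0≤1 1≤d) d≤N) α≈)))
      (≤-by 0≤θ (solve 2 (λ a t → t := a :+ t :+ (:- a)) refl (h ℚ.+ N ℚ.* θ) θ))

    at-least : ∀ {x ε} → 1ℚ ℚ.≤ x → 0ℚ ℚ.< ε → 1ℚ ℚ.≤ x ℚ.+ ε
    at-least {x} 1≤x 0<ε = ℚ.+-mono-≤ {1ℚ} {x} {0ℚ} 1≤x (ℚ.<⇒≤ 0<ε)

    at-most : ∀ {x y ε} → x ℚ.≤ N → N ℚ.≤ y → 0ℚ ℚ.< ε → x ℚ.≤ y ℚ.+ ε
    at-most {x} {y} {ε} x≤N N≤y 0<ε = subst (ℚ._≤ y ℚ.+ ε) (ℚ.+-identityʳ x)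
      (ℚ.+-mono-≤ (ℚ.≤-trans x≤N N≤y) (ℚ.<⇒≤ 0<ε))

    solution : Good → Solution
    solution (Good.even {a} {c = c} adj 1≤c c≤ X≤h) =
      fromℚ a , √2 * fromℚ c , even-normalized adj 1≤c ,
      (θ , 0<θ , ev-map
        (λ n (α≈ , e≤θ , N≤ , ≤N) → fits n (even-value n 1≤c (wc≤N n) X≤h α≈ e≤θ) N≤ ≤N)
        (proj₂ β-approx ⊗ err-scaled-small (ℚ.0≤∣p∣ (c ℚ.* β)) 0<θ ⊗ N≤M ⊗ M≤N+2η)) ,
      (λ δ 0<δ → 0 , λ n _ → at-least (*-mono {1ℚ} 0≤1 (0≤√2 n) (1≤√2 n) 1≤c) 0<δ) ,
      λ δ 0<δ → ev-map (λ n N≤ → at-most (wc≤N n) N≤ 0<δ) N≤M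
      where
      wc≤N : ∀ n → √2-approx n ℚ.* c ℚ.≤ N
      wc≤N n = √2*-≤ n {V} (0≤err m) 0≤N c≤
    solution (Good.odd {b = b} {d = d} adj 1≤d d≤N y≤) =
      √2 * fromℚ b , fromℚ d , odd-normalized adj 1≤d ,
      (θ , 0<θ , ev-map
        (λ n (α≈ , N≤ , ≤N) → fits n (odd-value n 1≤d d≤N y≤ α≈) N≤ ≤N)
        (proj₂ β-approx ⊗ N≤M ⊗ M≤N+2η)) ,
      (λ δ 0<δ → 0 , λ n _ → at-least 1≤d 0<δ) ,
      λ δ 0<δ → ev-map (λ n N≤ → at-most d≤N N≤ 0<δ) N≤M

    solved : Solution
    solved = solution (good adj⁺ adj⁻)

  admissible : Admissible α (fromℚ s)
  admissible = (s , 0<s , 0 , λ _ _ → ℚ.≤-reflexive (ℚ.+-identityˡ s)) ,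
    -- M ≥ 3 gives N ≥ 2, hence 2 ≤ V N, so that the edge with c = d = 1 fits.
    fromℚ (+ 3 ℚ./ 1) , solved

-- Openness of the cut above κ is used twice: s < r makes s a member below r, and s' < s leaves room
-- for the approximation errors.
upper : ∀ α → K α ≤ᵁ fromℝ κ
upper α r κ<r =
  let s , s<r , κ<s = UpperReal.open- (fromℝ κ) κ<r
      s' , s'<s , κ<s' = UpperReal.open- (fromℝ κ) κ<s
  in fromℚ s , Upper.admissible α s' s κ<s' s'<s ,
     r ℚ.- s , 0<-diff s<r , 0 , λ _ _ → ℚ.≤-reflexive
       (solve 2 (λ s r → s :+ (r :+ (:- s)) := r) refl s r)

-- Integers inside ℚ.

fromNat-+ : ∀ m n → fromNat (m ℕ.+ n) ≡ fromNat m ℚ.+ fromNat n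
fromNat-+ zero    n = sym (ℚ.+-identityˡ (fromNat n))
fromNat-+ (suc m) n = trans (cong (1ℚ ℚ.+_) (fromNat-+ m n)) (sym (ℚ.+-assoc 1ℚ (fromNat m) (fromNat n)))

fromNat-* : ∀ m n → fromNat (m ℕ.* n) ≡ fromNat m ℚ.* fromNat n
fromNat-* zero    n = sym (ℚ.*-zeroˡ (fromNat n))
fromNat-* (suc m) n = trans (fromNat-+ n (m ℕ.* n))
  (trans (cong (fromNat n ℚ.+_) (fromNat-* m n))
    (solve 2 (λ m n → n :+ m :* n := (con 1ℚ :+ m) :* n) refl (fromNat m) (fromNat n)))

fromNat-mono-≤ : ∀ {m n} → m ℕ.≤ n → fromNat m ℚ.≤ fromNat n
fromNat-mono-≤ {m} {n} m≤n = subst (fromNat m ℚ.≤_)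
  (trans (sym (fromNat-+ m (n ℕ.∸ m))) (cong fromNat (ℕ.m+[n∸m]≡n m≤n)))
  (≤-by (0≤fromNat (n ℕ.∸ m)) (solve 2 (λ m k → k := (m :+ k) :+ (:- m)) refl (fromNat m) (fromNat (n ℕ.∸ m))))

fromNat-cancel-< : ∀ {m n} → fromNat m ℚ.< fromNat n → m ℕ.< n
fromNat-cancel-< h = ℕ.≰⇒> λ n≤m → ℚ.<-irrefl refl (ℚ.<-≤-trans h (fromNat-mono-≤ n≤m))

-- Integers stay in ℚ, where the ring solver and the order are at hand; only positive ones are
-- passed on to ℕ and the Pell equation.
record Integral (x : ℚ) : Set where
  constructor difference
  field
    m n : ℕ
    x≡  : x ≡ fromNat m ℚ.- fromNat n

integral-fromNat : ∀ n → Integral (fromNat n)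
integral-fromNat n = difference n 0 (solve 1 (λ x → x := x :+ (:- con 0ℚ)) refl (fromNat n))

integral-neg : ∀ {x} → Integral x → Integral (ℚ.- x)
integral-neg (difference m n refl) = difference n m
  (solve 2 (λ a b → :- (a :+ (:- b)) := b :+ (:- a)) refl (fromNat m) (fromNat n))

integral-+ : ∀ {x y} → Integral x → Integral y → Integral (x ℚ.+ y)
integral-+ (difference m n refl) (difference k l refl) = difference (m ℕ.+ k) (n ℕ.+ l)
  (trans (solve 4 (λ a b c d → (a :+ (:- b)) :+ (c :+ (:- d)) := (a :+ c) :+ (:- (b :+ d))) refl
      (fromNat m) (fromNat n) (fromNat k) (fromNat l))
    (sym (cong₂ ℚ._-_ (fromNat-+ m k) (fromNat-+ n l))))

integral-* : ∀ {x y} → Integral x → Integral y → Integral (x ℚ.* y)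
integral-* (difference m n refl) (difference k l refl) =
  difference (m ℕ.* k ℕ.+ n ℕ.* l) (m ℕ.* l ℕ.+ n ℕ.* k)
  (trans (solve 4 (λ a b c d → (a :+ (:- b)) :* (c :+ (:- d)) := (a :* c :+ b :* d) :+ (:- (a :* d :+ b :* c))) refl
      (fromNat m) (fromNat n) (fromNat k) (fromNat l))
    (sym (cong₂ ℚ._-_ (hom m k n l) (hom m l n k))))
  where
  hom : ∀ a b c d → fromNat (a ℕ.* b ℕ.+ c ℕ.* d) ≡ fromNat a ℚ.* fromNat b ℚ.+ fromNat c ℚ.* fromNat d
  hom a b c d = trans (fromNat-+ (a ℕ.* b) (c ℕ.* d)) (cong₂ ℚ._+_ (fromNat-* a b) (fromNat-* c d))

integral-sign : ∀ {x} → Integral x → ∃[ n ] (x ≡ fromNat n ⊎ x ≡ ℚ.- fromNat (suc n))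
integral-sign (difference m n refl) with ℕ.≤-<-connex n m
... | inj₁ n≤m = m ℕ.∸ n , inj₁ (trans
  (cong (ℚ._- fromNat n) (trans (cong fromNat (sym (ℕ.m+[n∸m]≡n n≤m))) (fromNat-+ n (m ℕ.∸ n))))
  (solve 2 (λ n k → (n :+ k) :+ (:- n) := k) refl (fromNat n) (fromNat (m ℕ.∸ n))))
... | inj₂ m<n = n ℕ.∸ suc m , inj₂ (trans
  (cong (λ k → fromNat m ℚ.- k) (trans (cong fromNat (sym (ℕ.m+[n∸m]≡n m<n))) (fromNat-+ (suc m) (n ℕ.∸ suc m))))
  (solve 2 (λ m k → m :+ (:- (con 1ℚ :+ m :+ k)) := :- (con 1ℚ :+ k)) refl (fromNat m) (fromNat (n ℕ.∸ suc m))))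

positive-integral : ∀ {x} → Integral x → 0ℚ ℚ.< x → ∃[ n ] x ≡ fromNat n
positive-integral i 0<x with integral-sign i
... | n , inj₁ eq = n , eq
... | n , inj₂ refl = ⊥-elim (ℚ.<-irrefl refl (ℚ.<-≤-trans 0<x (ℚ.neg-antimono-≤ (0≤fromNat (suc n)))))

positive-odd : ∀ {y} → Integral y → 0ℚ ℚ.< 1ℚ ℚ.+ (y ℚ.+ y) → ∃[ n ] 1ℚ ℚ.+ (y ℚ.+ y) ≡ fromNat (suc (n ℕ.+ n))
positive-odd i 0<s with integral-sign i
... | n , inj₁ refl = n , cong (1ℚ ℚ.+_) (sym (fromNat-+ n n))
... | n , inj₂ refl = ⊥-elim (⊥-by (+-0< (+-0< 0<s 0≤1) (+-0≤ (0≤fromNat n) (0≤fromNat n)))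
  (solve 1 (λ k → (con 1ℚ :+ ((:- (con 1ℚ :+ k)) :+ (:- (con 1ℚ :+ k)))) :+ con 1ℚ :+ (k :+ k) := con 0ℚ)
    refl (fromNat n)))

-- Equality of reals as a congruence.

≃-sym : ∀ {x y} → x ≃ y → y ≃ x
≃-sym {x} {y} h ε 0<ε = ev-map (λ n → subst (ℚ._≤ ε) (∣p-q∣≡∣q-p∣ (seq x n) (seq y n))) (h ε 0<ε)

≃-trans : ∀ {x y z} → x ≃ y → y ≃ z → x ≃ z
≃-trans {x} {y} {z} h k ε 0<ε = ev-map
  (λ n (a , b) → subst₂ ℚ._≤_
    (cong ℚ.∣_∣ (solve 3 (λ x y z → (x :+ (:- y)) :+ (y :+ (:- z)) := x :+ (:- z)) refl
      (seq x n) (seq y n) (seq z n)))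
    (half+half ε) (∣u+v∣≤ a b))
  (h (½ ℚ.* ε) (half-pos 0<ε) ⊗ k (½ ℚ.* ε) (half-pos 0<ε))

-‿cong : ∀ {x x'} → x ≃ x' → - x ≃ - x'
-‿cong {x} {x'} h ε 0<ε = ev-map (λ n → subst (ℚ._≤ ε)
  (trans (∣p-q∣≡∣q-p∣ (seq x n) (seq x' n))
    (cong ℚ.∣_∣ (solve 2 (λ x y → y :+ (:- x) := (:- x) :+ (:- (:- y))) refl (seq x n) (seq x' n))))) (h ε 0<ε)

+-cong : ∀ {x x' y y'} → x ≃ x' → y ≃ y' → x + y ≃ x' + y'
+-cong {x} {x'} {y} {y'} h k ε 0<ε = ev-map
  (λ n (a , b) → subst₂ ℚ._≤_
    (cong ℚ.∣_∣ (solve 4 (λ x x' y y' → (x :+ (:- x')) :+ (y :+ (:- y')) := (x :+ y) :+ (:- (x' :+ y'))) refl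
      (seq x n) (seq x' n) (seq y n) (seq y' n)))
    (half+half ε) (∣u+v∣≤ a b))
  (h (½ ℚ.* ε) (half-pos 0<ε) ⊗ k (½ ℚ.* ε) (half-pos 0<ε))

*-cong : ∀ {x x' y y'} → x ≃ x' → y ≃ y' → x * y ≃ x' * y'
*-cong {x} {x'} {y} {y'} h k ε 0<ε =
  let A , 0<A , hA = bounded x'
      B , 0<B , hB = bounded y
      δ = λ C → ½ ℚ.* ε ℚ.* recip C
      0<δ = λ {C} (0<C : 0ℚ ℚ.< C) → *-0< (half-pos 0<ε) (recip-pos 0<C)
  in ev-map
    (λ n (a , b , x'≤ , y≤) → subst₂ ℚ._≤_
      (cong ℚ.∣_∣ (solve 4 (λ x x' y y' → (x :+ (:- x')) :* y :+ (y :+ (:- y')) :* x' := x :* y :+ (:- (x' :* y'))) refl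
        (seq x n) (seq x' n) (seq y n) (seq y' n)))
      (trans (cong₂ ℚ._+_ (cancel 0<B) (cancel 0<A)) (half+half ε))
      (∣u+v∣≤ (∣u*v∣≤ a y≤) (∣u*v∣≤ b x'≤)))
    (h (δ B) (0<δ 0<B) ⊗ k (δ A) (0<δ 0<A) ⊗ hA ⊗ hB)
  where
  cancel : ∀ {C} → 0ℚ ℚ.< C → ½ ℚ.* ε ℚ.* recip C ℚ.* C ≡ ½ ℚ.* ε
  cancel {C} 0<C = trans (solve 3 (λ e r c → e :* r :* c := e :* (c :* r)) refl (½ ℚ.* ε) (recip C) C)
    (trans (cong (½ ℚ.* ε ℚ.*_) (recip-inverse 0<C)) (ℚ.*-identityʳ (½ ℚ.* ε)))

-- Parity of the entries of matrices in H₄.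

oddℝ : ℚ → ℝ
oddℝ y = fromℚ (1ℚ ℚ.+ (y ℚ.+ y))

OddInteger √2-Multiple : ℝ → Set
OddInteger  x = ∃[ y ] (Integral y × x ≃ oddℝ y)
√2-Multiple x = ∃[ t ] (Integral t × x ≃ √2 * fromℚ t)

odd-resp : ∀ {x x'} → x ≃ x' → OddInteger x → OddInteger x'
odd-resp {x} {x'} h (y , i , eq) = y , i , ≃-trans {x'} {x} {oddℝ y} (≃-sym {x} {x'} h) eq

mult-resp : ∀ {x x'} → x ≃ x' → √2-Multiple x → √2-Multiple x'
mult-resp {x} {x'} h (t , i , eq) = t , i , ≃-trans {x'} {x} {√2 * fromℚ t} (≃-sym {x} {x'} h) eq

odd-neg : ∀ {x} → OddInteger x → OddInteger (- x)
odd-neg {x} (y , i , eq) = ℚ.- 1ℚ ℚ.- y , integral-+ (integral-neg (integral-fromNat 1)) (integral-neg i) ,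
  ≃-trans { - x} { - oddℝ y} {oddℝ (ℚ.- 1ℚ ℚ.- y)} (-‿cong {x} {oddℝ y} eq)
    (≃-pointwise (- oddℝ y) (oddℝ (ℚ.- 1ℚ ℚ.- y)) λ _ →
      solve 1 (λ y → let z = (:- con 1ℚ) :+ (:- y) in :- (con 1ℚ :+ (y :+ y)) := con 1ℚ :+ (z :+ z)) refl y)

mult-neg : ∀ {x} → √2-Multiple x → √2-Multiple (- x)
mult-neg {x} (t , i , eq) = ℚ.- t , integral-neg i ,
  ≃-trans { - x} { - (√2 * fromℚ t)} {√2 * fromℚ (ℚ.- t)} (-‿cong {x} {√2 * fromℚ t} eq)
    (≃-pointwise (- (√2 * fromℚ t)) (√2 * fromℚ (ℚ.- t)) λ n →
      solve 2 (λ w t → :- (w :* t) := w :* (:- t)) refl (√2-approx n) t)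

+-comm : ∀ x y → x + y ≃ y + x
+-comm x y = ≃-pointwise (x + y) (y + x) λ n → ℚ.+-comm (seq x n) (seq y n)

-- Two multiples √2 z and √2 t have the even product 2zt, which leaves an odd product odd.
odd-mult : ∀ {a b c d} → OddInteger a → OddInteger b → √2-Multiple c → √2-Multiple d →
           OddInteger (a * b + c * d)
odd-mult {a} {b} {c} {d} (x , ix , ex) (y , iy , ey) (z , iz , ez) (t , it , et) =
  r , integral-+ (integral-+ ix iy) (integral-+ (integral-+ (integral-* ix iy) (integral-* ix iy)) (integral-* iz it)) ,
  ≃-trans {a * b + c * d} {standard} {oddℝ r}
    (+-cong {a * b} {oddℝ x * oddℝ y} {c * d} {√2 * fromℚ z * (√2 * fromℚ t)}
      (*-cong {a} {oddℝ x} {b} {oddℝ y} ex ey) (*-cong {c} {√2 * fromℚ z} {d} {√2 * fromℚ t} ez et))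
    (≃-mod standard (oddℝ r) (fromℚ (ℚ.- (z ℚ.* t))) λ n →
      solve 5 (λ x y z t w → let r = (x :+ y) :+ ((x :* y :+ x :* y) :+ z :* t) in
        ((con 1ℚ :+ (x :+ x)) :* (con 1ℚ :+ (y :+ y)) :+ w :* z :* (w :* t)) :+ (:- (con 1ℚ :+ (r :+ r)))
        := (:- (z :* t)) :* (con 2ℚ :+ (:- (w :* w)))) refl x y z t (√2-approx n))
  where
  r = (x ℚ.+ y) ℚ.+ ((x ℚ.* y ℚ.+ x ℚ.* y) ℚ.+ z ℚ.* t)
  standard = oddℝ x * oddℝ y + √2 * fromℚ z * (√2 * fromℚ t)

mult-odd : ∀ {a b c d} → √2-Multiple a → √2-Multiple b → OddInteger c → OddInteger d →
           OddInteger (a * b + c * d)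
mult-odd {a} {b} {c} {d} ha hb hc hd =
  odd-resp {c * d + a * b} {a * b + c * d} (+-comm (c * d) (a * b)) (odd-mult {c} {d} {a} {b} hc hd ha hb)

cross : ∀ {a b c d} → OddInteger a → √2-Multiple b → √2-Multiple c → OddInteger d →
        √2-Multiple (a * b + c * d)
cross {a} {b} {c} {d} (x , ix , ex) (y , iy , ey) (z , iz , ez) (t , it , et) =
  r , integral-+ (integral-* odd-x iy) (integral-* iz odd-t) ,
  ≃-trans {a * b + c * d} {standard} {√2 * fromℚ r}
    (+-cong {a * b} {oddℝ x * (√2 * fromℚ y)} {c * d} {√2 * fromℚ z * oddℝ t}
      (*-cong {a} {oddℝ x} {b} {√2 * fromℚ y} ex ey) (*-cong {c} {√2 * fromℚ z} {d} {oddℝ t} ez et))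
    (≃-pointwise standard (√2 * fromℚ r) λ n →
      solve 5 (λ x y z t w →
        (con 1ℚ :+ (x :+ x)) :* (w :* y) :+ w :* z :* (con 1ℚ :+ (t :+ t))
        := w :* ((con 1ℚ :+ (x :+ x)) :* y :+ z :* (con 1ℚ :+ (t :+ t)))) refl x y z t (√2-approx n))
  where
  r = (1ℚ ℚ.+ (x ℚ.+ x)) ℚ.* y ℚ.+ z ℚ.* (1ℚ ℚ.+ (t ℚ.+ t))
  odd-x = integral-+ (integral-fromNat 1) (integral-+ ix ix)
  odd-t = integral-+ (integral-fromNat 1) (integral-+ it it)
  standard = oddℝ x * (√2 * fromℚ y) + √2 * fromℚ z * oddℝ t

cross' : ∀ {a b c d} → √2-Multiple a → OddInteger b → OddInteger c → √2-Multiple d →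
         √2-Multiple (a * b + c * d)
cross' {a} {b} {c} {d} ha hb hc hd =
  mult-resp {c * d + a * b} {a * b + c * d} (+-comm (c * d) (a * b)) (cross {c} {d} {a} {b} hc hd ha hb)

neg-neg : ∀ x → - (- x) ≃ x
neg-neg x = ≃-pointwise (- (- x)) x λ n → solve 1 (λ x → :- (:- x) := x) refl (seq x n)

odd-opp : ∀ {x x'} → x ≃ - x' → OddInteger x → OddInteger x'
odd-opp {x} {x'} h o = odd-resp {x = - (- x')} {x'} (neg-neg x') (odd-neg { - x'} (odd-resp {x} { - x'} h o))

mult-opp : ∀ {x x'} → x ≃ - x' → √2-Multiple x → √2-Multiple x'
mult-opp {x} {x'} h o = mult-resp {x = - (- x')} {x'} (neg-neg x') (mult-neg { - x'} (mult-resp {x} { - x'} h o))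

odd-1 : OddInteger 1ℝ
odd-1 = 0ℚ , integral-fromNat 0 , ≃-refl {1ℝ}

mult-0 : √2-Multiple 0ℝ
mult-0 = 0ℚ , integral-fromNat 0 , 0≃√2*0

Parity : Matrix → Set
Parity ⟦ a , b ⨾ c , d ⟧ =
  (OddInteger a × √2-Multiple b × √2-Multiple c × OddInteger d) ⊎
  (√2-Multiple a × OddInteger b × OddInteger c × √2-Multiple d)

-- Each generator has one of the two shapes, and shapes multiply like signs: equal ones give the
-- first, different ones the second.
parity : ∀ {A} → H₄ A → Parity A
parity translation = inj₁ (odd-1 , (1ℚ , integral-fromNat 1 ,
    ≃-pointwise √2 (√2 * fromℚ 1ℚ) λ n → sym (ℚ.*-identityʳ (√2-approx n))) , mult-0 , odd-1)
parity involution = inj₂ (mult-0 , odd-neg {1ℝ} odd-1 , odd-1 , mult-0)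
parity unit = inj₁ (odd-1 , mult-0 , mult-0 , odd-1)
parity (product {⟦ a , b ⨾ c , d ⟧} {⟦ a' , b' ⨾ c' , d' ⟧} g h) with parity g | parity h
... | inj₁ (A , B , C , D) | inj₁ (A' , B' , C' , D') = inj₁
  ( odd-mult {a} {a'} {b} {c'} A A' B C' , cross {a} {b'} {b} {d'} A B' B D'
  , cross' {c} {a'} {d} {c'} C A' D C' , mult-odd {c} {b'} {d} {d'} C B' D D' )
... | inj₁ (A , B , C , D) | inj₂ (A' , B' , C' , D') = inj₂
  ( cross {a} {a'} {b} {c'} A A' B C' , odd-mult {a} {b'} {b} {d'} A B' B D'
  , mult-odd {c} {a'} {d} {c'} C A' D C' , cross' {c} {b'} {d} {d'} C B' D D' )
... | inj₂ (A , B , C , D) | inj₁ (A' , B' , C' , D') = inj₂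
  ( cross' {a} {a'} {b} {c'} A A' B C' , mult-odd {a} {b'} {b} {d'} A B' B D'
  , odd-mult {c} {a'} {d} {c'} C A' D C' , cross {c} {b'} {d} {d'} C B' D D' )
... | inj₂ (A , B , C , D) | inj₂ (A' , B' , C' , D') = inj₁
  ( mult-odd {a} {a'} {b} {c'} A A' B C' , cross' {a} {b'} {b} {d'} A B' B D'
  , cross {c} {a'} {d} {c'} C A' D C' , odd-mult {c} {b'} {d} {d'} C B' D D' )
parity (invert {⟦ a , b ⨾ c , d ⟧} h) with parity h
... | inj₁ (A , B , C , D) = inj₁ (D , mult-neg {b} B , mult-neg {c} C , A)
... | inj₂ (A , B , C , D) = inj₂ (D , odd-neg {b} B , odd-neg {c} C , A)
parity (respects {⟦ a , b ⨾ c , d ⟧} {⟦ a' , b' ⨾ c' , d' ⟧} (inj₁ (ea , eb , ec , ed)) h) with parity h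
... | inj₁ (A , B , C , D) = inj₁
  (odd-resp {a} {a'} ea A , mult-resp {b} {b'} eb B , mult-resp {c} {c'} ec C , odd-resp {d} {d'} ed D)
... | inj₂ (A , B , C , D) = inj₂
  (mult-resp {a} {a'} ea A , odd-resp {b} {b'} eb B , odd-resp {c} {c'} ec C , mult-resp {d} {d'} ed D)
parity (respects {⟦ a , b ⨾ c , d ⟧} {⟦ a' , b' ⨾ c' , d' ⟧} (inj₂ (ea , eb , ec , ed)) h) with parity h
... | inj₁ (A , B , C , D) = inj₁
  (odd-opp {a} {a'} ea A , mult-opp {b} {b'} eb B , mult-opp {c} {c'} ec C , odd-opp {d} {d'} ed D)
... | inj₂ (A , B , C , D) = inj₂
  (mult-opp {a} {a'} ea A , odd-opp {b} {b'} eb B , odd-opp {c} {c'} ec C , mult-opp {d} {d'} ed D)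

-- The lower bound K(1) ≥ κ.

-- By squares: 2S² ≤ 4T² + 2 < (2T + 2)². For ν = S + 2T - 1 it yields ν ≥ (√2 + 1) S - 3.
√2*S≤ : ∀ i {S T} → 0ℚ ℚ.≤ T → S ℚ.* S ℚ.≤ T ℚ.* T ℚ.+ T ℚ.* T ℚ.+ 1ℚ →
        √2-approx i ℚ.* S ℚ.≤ T ℚ.+ T ℚ.+ 2ℚ
√2*S≤ i {S} {T} 0≤T S²≤ with ℚ.≤-total (√2-approx i ℚ.* S) (T ℚ.+ T ℚ.+ 2ℚ)
... | inj₁ ≤ = ≤
... | inj₂ ≥ = ⊥-elim (⊥-by
  (+-0< (+-0< (+-0< (+-0< (0<con 2ℚ)
    (*-0≤ (0≤-diff ≥) (+-0≤ (ℚ.≤-trans 0≤2T+2 ≥) 0≤2T+2)))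
    (*-0≤ (0≤err i) (0≤sq S)))
    (*-0≤ (0≤con 2ℚ) (0≤-diff S²≤)))
    (*-0≤ (0≤con (+ 8 ℚ./ 1)) 0≤T))
  (solve 3 (λ w S T → let u = T :+ T :+ con 2ℚ in
    con 2ℚ :+ (w :* S :+ (:- u)) :* (w :* S :+ u) :+ (con 2ℚ :+ (:- (w :* w))) :* (S :* S)
      :+ con 2ℚ :* (T :* T :+ T :* T :+ con 1ℚ :+ (:- (S :* S))) :+ con (+ 8 ℚ./ 1) :* T := con 0ℚ)
    refl (√2-approx i) S T))
  where
  0≤2T+2 = +-0≤ (+-0≤ 0≤T 0≤T) (0≤con 2ℚ)

-- p and q are s and √2 t in one order or the other; ν bounds q.
module Approximation
  (i : ℕ) {s t ν k ε : ℚ}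
  (10≤ν : + 10 ℚ./ 1 ℚ.≤ ν) (0<ε : 0ℚ ℚ.< ε)
  (k+ε≤κ : k ℚ.+ ε ℚ.≤ seq κ i)
  (close : ℚ.∣ s ℚ.- √2-approx i ℚ.* t ∣ ℚ.≤ k ℚ.* recip ν)
  (range : (½ ℚ.≤ s × s ℚ.≤ ν ℚ.+ ½) ⊎
           (½ ℚ.≤ √2-approx i ℚ.* t × √2-approx i ℚ.* t ℚ.≤ ν ℚ.+ ½))
  where

  private
    w = √2-approx i
    x = s ℚ.- w ℚ.* t
    g = ℚ.∣ x ∣
    0≤g = ℚ.0≤∣p∣ x
    0<ν = ℚ.<-≤-trans (0<con (+ 10 ℚ./ 1)) 10≤ν
    0≤ν = ℚ.<⇒≤ 0<ν
    0≤ε = ℚ.<⇒≤ 0<ε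

    gν≤κ-ε : g ℚ.* ν ℚ.≤ (w ℚ.+ 1ℚ) ℚ.* ½ ℚ.- ε
    gν≤κ-ε = ℚ.≤-trans (*-mono 0≤ν (ℚ.≤-trans 0≤g close) close ℚ.≤-refl)
      (≤-by (0≤-diff k+ε≤κ)
        (trans (solve 3 (λ k ε c → c :+ (:- (k :+ ε)) := (c :+ (:- ε)) :+ (:- (k :* con 1ℚ))) refl k ε (seq κ i))
          (cong (λ u → seq κ i ℚ.- ε ℚ.- u) (trans (cong (k ℚ.*_) (sym (recip-inverse 0<ν)))
            (solve 3 (λ k r ν → k :* (ν :* r) := k :* r :* ν) refl k (recip ν) ν)))))

    gν≤5/4 : g ℚ.* ν ℚ.≤ + 5 ℚ./ 4
    gν≤5/4 = ≤-by (+-0≤ (+-0≤ (0≤-diff gν≤κ-ε) 0≤ε) (*-0≤ (0≤con ½) (0≤-diff (√2≤3/2 i))))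
      (solve 3 (λ u w ε → ((w :+ con 1ℚ) :* con ½ :+ (:- ε) :+ (:- u)) :+ ε :+ con ½ :* (con (+ 3 ℚ./ 2) :+ (:- w))
        := con (+ 5 ℚ./ 4) :+ (:- u)) refl (g ℚ.* ν) w ε)

    -- From g ν ≤ 5/4 and ν ≥ 10. So s and √2 t differ by at most ⅛, and bounds on the one that is
    -- the denominator pass to the other.
    g≤⅛ : g ℚ.≤ + 1 ℚ./ 8
    g≤⅛ = ≤-by (*-0≤ (0≤con (+ 1 ℚ./ 10)) (+-0≤ (0≤-diff gν≤5/4) (*-0≤ 0≤g (0≤-diff 10≤ν))))
      (solve 2 (λ g ν → con (+ 1 ℚ./ 10) :* ((con (+ 5 ℚ./ 4) :+ (:- (g :* ν))) :+ g :* (ν :+ (:- con (+ 10 ℚ./ 1))))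
        := con (+ 1 ℚ./ 8) :+ (:- g)) refl g ν)

    x≤g : x ℚ.≤ g
    x≤g = p≤∣p∣ x

    -x≤g : ℚ.- x ℚ.≤ g
    -x≤g = subst (ℚ.- x ℚ.≤_) (ℚ.∣-p∣≡∣p∣ x) (p≤∣p∣ (ℚ.- x))

    transfer≤ : ∀ {a b c} → a ℚ.- b ℚ.≤ g → b ℚ.≤ c → a ℚ.≤ c ℚ.+ + 1 ℚ./ 8
    transfer≤ {a} {b} {c} h b≤c = ≤-by (+-0≤ (+-0≤ (0≤-diff h) (0≤-diff b≤c)) (0≤-diff g≤⅛))
      (solve 4 (λ a b c g → (g :+ (:- (a :+ (:- b)))) :+ (c :+ (:- b)) :+ (con (+ 1 ℚ./ 8) :+ (:- g))
        := (c :+ con (+ 1 ℚ./ 8)) :+ (:- a)) refl a b c g)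

    transfer≥ : ∀ {a b} → b ℚ.- a ℚ.≤ g → ½ ℚ.≤ b → + 3 ℚ./ 8 ℚ.≤ a
    transfer≥ {a} {b} h ½≤b = ≤-by (+-0≤ (+-0≤ (0≤-diff h) (0≤-diff ½≤b)) (0≤-diff g≤⅛))
      (solve 3 (λ a b g → (g :+ (:- (b :+ (:- a)))) :+ (b :+ (:- con ½)) :+ (con (+ 1 ℚ./ 8) :+ (:- g))
        := a :+ (:- con (+ 3 ℚ./ 8))) refl a b g)

    wt-s≤g : w ℚ.* t ℚ.- s ℚ.≤ g
    wt-s≤g = subst (ℚ._≤ g) (solve 2 (λ a b → :- (a :+ (:- b)) := b :+ (:- a)) refl s (w ℚ.* t)) -x≤g

    weaken : ∀ {a} → ½ ℚ.≤ a → + 3 ℚ./ 8 ℚ.≤ a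
    weaken = ℚ.≤-trans (toWitness {a? = + 3 ℚ./ 8 ℚ.≤? ½} _)

    3/8≤s : + 3 ℚ./ 8 ℚ.≤ s
    3/8≤s = Sum.[ (λ (l , _) → weaken l) , (λ (l , _) → transfer≥ wt-s≤g l) ]′ range

    3/8≤wt : + 3 ℚ./ 8 ℚ.≤ w ℚ.* t
    3/8≤wt = Sum.[ (λ (l , _) → transfer≥ x≤g l) , (λ (l , _) → weaken l) ]′ range

    s+wt≤ : s ℚ.+ w ℚ.* t ℚ.≤ ν ℚ.+ ν ℚ.+ + 9 ℚ./ 8
    s+wt≤ = Sum.[
      (λ (_ , u) → sum u (transfer≤ wt-s≤g u) refl) ,
      (λ (_ , u) → sum u (transfer≤ x≤g u) (ℚ.+-comm s (w ℚ.* t))) ]′ range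
      where
      sum : ∀ {a b c} → a ℚ.≤ ν ℚ.+ ½ → b ℚ.≤ ν ℚ.+ ½ ℚ.+ + 1 ℚ./ 8 → c ≡ a ℚ.+ b → c ℚ.≤ ν ℚ.+ ν ℚ.+ + 9 ℚ./ 8
      sum {a} {b} h h' refl = ℚ.≤-trans (ℚ.+-mono-≤ h h') (ℚ.≤-reflexive
        (solve 1 (λ ν → (ν :+ con ½) :+ (ν :+ con ½ :+ con (+ 1 ℚ./ 8)) := ν :+ ν :+ con (+ 9 ℚ./ 8)) refl ν))

    0≤s+wt : 0ℚ ℚ.≤ s ℚ.+ w ℚ.* t
    0≤s+wt = +-0≤ (ℚ.≤-trans (0≤con (+ 3 ℚ./ 8)) 3/8≤s) (ℚ.≤-trans (0≤con (+ 3 ℚ./ 8)) 3/8≤wt)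

  0<s : 0ℚ ℚ.< s
  0<s = ℚ.<-≤-trans (0<con (+ 3 ℚ./ 8)) 3/8≤s

  0<t : 0ℚ ℚ.< t
  0<t = ℚ.≰⇒> λ t≤0 → ℚ.<-irrefl refl (ℚ.<-≤-trans (0<con (+ 3 ℚ./ 8)) (ℚ.≤-trans 3/8≤wt
    (≤-by (*-0≤ (0≤√2 i) (ℚ.neg-antimono-≤ t≤0))
      (solve 2 (λ w t → w :* (:- t) := con 0ℚ :+ (:- (w :* t))) refl w t))))

  s<1+ν : s ℚ.< 1ℚ ℚ.+ ν
  s<1+ν = ℚ.≤-<-trans
    (Sum.[
      (λ (_ , u) → ℚ.≤-trans u (≤-by (0≤con (+ 1 ℚ./ 8))
        (solve 1 (λ u → con (+ 1 ℚ./ 8) := (u :+ con (+ 1 ℚ./ 8)) :+ (:- u)) refl (ν ℚ.+ ½)))) ,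
      (λ (_ , u) → transfer≤ x≤g u) ]′ range)
    (<-by (0<con (+ 3 ℚ./ 8)) (solve 1 (λ ν → con (+ 3 ℚ./ 8)
      := (con 1ℚ :+ ν) :+ (:- (ν :+ con ½ :+ con (+ 1 ℚ./ 8)))) refl ν))

  -- The product |s - √2 t| (s + √2 t) is at most g (2ν + 9/8) ≤ 5/2 + 9/64, which is 23/64 short of
  -- 3. In `2t²<s²+3` the deficit of the approximation of √2 costs another 1/16.
  s²<2t²+3 : s ℚ.* s ℚ.< t ℚ.* t ℚ.+ t ℚ.* t ℚ.+ + 3 ℚ./ 1
  s²<2t²+3 = <-by
    (+-0< (+-0< (+-0< (+-0< (+-0< (0<con (+ 23 ℚ./ 64))
      (*-0≤ (0≤err i) (0≤sq t)))
      (*-0≤ (0≤-diff x≤g) 0≤s+wt))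
      (*-0≤ 0≤g (0≤-diff s+wt≤)))
      (*-0≤ (0≤con 2ℚ) (0≤-diff gν≤5/4)))
      (*-0≤ (0≤con (+ 9 ℚ./ 8)) (0≤-diff g≤⅛)))
    (solve 5 (λ s t w g ν →
      con (+ 23 ℚ./ 64) :+ (con 2ℚ :+ (:- (w :* w))) :* (t :* t)
      :+ (g :+ (:- (s :+ (:- (w :* t))))) :* (s :+ w :* t)
      :+ g :* (ν :+ ν :+ con (+ 9 ℚ./ 8) :+ (:- (s :+ w :* t)))
      :+ con 2ℚ :* (con (+ 5 ℚ./ 4) :+ (:- (g :* ν)))
      :+ con (+ 9 ℚ./ 8) :* (con (+ 1 ℚ./ 8) :+ (:- g))
      := (t :* t :+ t :* t :+ con (+ 3 ℚ./ 1)) :+ (:- (s :* s))) refl s t w g ν)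

  2t²<s²+3 : err w ℚ.* (t ℚ.* t) ℚ.≤ + 1 ℚ./ 16 → t ℚ.* t ℚ.+ t ℚ.* t ℚ.< s ℚ.* s ℚ.+ + 3 ℚ./ 1
  2t²<s²+3 et²≤ = <-by
    (+-0< (+-0< (+-0< (+-0< (+-0< (0<con (+ 19 ℚ./ 64))
      (0≤-diff et²≤))
      (*-0≤ (0≤-diff -x≤g) 0≤s+wt))
      (*-0≤ 0≤g (0≤-diff s+wt≤)))
      (*-0≤ (0≤con 2ℚ) (0≤-diff gν≤5/4)))
      (*-0≤ (0≤con (+ 9 ℚ./ 8)) (0≤-diff g≤⅛)))
    (solve 5 (λ s t w g ν →
      con (+ 19 ℚ./ 64) :+ (con (+ 1 ℚ./ 16) :+ (:- ((con 2ℚ :+ (:- (w :* w))) :* (t :* t))))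
      :+ (g :+ (:- (:- (s :+ (:- (w :* t)))))) :* (s :+ w :* t)
      :+ g :* (ν :+ ν :+ con (+ 9 ℚ./ 8) :+ (:- (s :+ w :* t)))
      :+ con 2ℚ :* (con (+ 5 ℚ./ 4) :+ (:- (g :* ν)))
      :+ con (+ 9 ℚ./ 8) :* (con (+ 1 ℚ./ 8) :+ (:- g))
      := (s :* s :+ con (+ 3 ℚ./ 1)) :+ (:- (t :* t :+ t :* t))) refl s t w g ν)

  -- |s − √2 t| = 1 / (s + √2 t) ≥ 1 / (2S + 1) up to O(e), whereas
  -- ν ≥ (√2 + 1) S − 3.
  refute : ∀ {S T} → ν ≡ S ℚ.+ (T ℚ.+ T) ℚ.- 1ℚ → 0ℚ ℚ.≤ S → 0ℚ ℚ.≤ T →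
           S ℚ.* S ℚ.≤ T ℚ.* T ℚ.+ T ℚ.* T ℚ.+ 1ℚ → s ℚ.≤ S →
           (s ℚ.* s ≡ 1ℚ ℚ.+ (t ℚ.* t ℚ.+ t ℚ.* t)) ⊎ (1ℚ ℚ.+ s ℚ.* s ≡ t ℚ.* t ℚ.+ t ℚ.* t) →
           + 3 ℚ./ 1 ℚ.≤ ε ℚ.* S → err w ℚ.* (ν ℚ.* (t ℚ.* t)) ℚ.≤ 1ℚ → ⊥
  refute {S} {T} refl 0≤S 0≤T S²≤ s≤S norm 3≤εS eνt²≤1 = ⊥-by
    -- Chained, with w for √2 and e = 2 - w²: (w + 1) S - 4 ≤ ν - 1 ≤ ν (1 - e t²) ≤ ν g (2S + 1) ≤
    -- (2S + 1)((w + 1)/2 - ε). Hence (2S + 1) ε ≤ 4 + 5/4, against ε S ≥ 3.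
    (+-0< (+-0< (+-0< (+-0< (+-0< (+-0< (+-0< (+-0< (0<con (+ 3 ℚ./ 4))
      0≤ε)
      (*-0≤ 0≤2S+1 (0≤-diff gν≤κ-ε)))
      (*-0≤ 0≤ν (0≤-diff (one≤ norm))))
      (*-0≤ (*-0≤ 0≤ν 0≤g) (0≤-diff Σ≤)))
      (0≤-diff eνt²≤1))
      (0≤-diff (√2*S≤ i 0≤T S²≤)))
      (*-0≤ (0≤con 2ℚ) (0≤-diff 3≤εS)))
      (*-0≤ (0≤con ½) (0≤-diff (√2≤3/2 i))))
    (solve 7 (λ s t w g S T ε →
       let ν = S :+ (T :+ T) :+ (:- con 1ℚ)
           e = con 2ℚ :+ (:- (w :* w))
       in con (+ 3 ℚ./ 4) :+ ε
       :+ (S :+ S :+ con 1ℚ) :* ((w :+ con 1ℚ) :* con ½ :+ (:- ε) :+ (:- (g :* ν)))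
       :+ ν :* (g :* (s :+ w :* t) :+ (:- (con 1ℚ :+ (:- (e :* (t :* t))))))
       :+ ν :* g :* (S :+ S :+ con 1ℚ :+ (:- (s :+ w :* t)))
       :+ (con 1ℚ :+ (:- (e :* (ν :* (t :* t)))))
       :+ (T :+ T :+ con 2ℚ :+ (:- (w :* S)))
       :+ con 2ℚ :* (ε :* S :+ (:- con (+ 3 ℚ./ 1)))
       :+ con ½ :* (con (+ 3 ℚ./ 2) :+ (:- w)) := con 0ℚ) refl s t w g S T ε)
    where
    0≤2S+1 : 0ℚ ℚ.≤ S ℚ.+ S ℚ.+ 1ℚ
    0≤2S+1 = +-0≤ (+-0≤ 0≤S 0≤S) 0≤1

    Σ≤ : s ℚ.+ w ℚ.* t ℚ.≤ S ℚ.+ S ℚ.+ 1ℚ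
    Σ≤ = ≤-by (+-0≤ (+-0≤ (*-0≤ (0≤con 2ℚ) (0≤-diff s≤S)) (0≤-diff (transfer≤ wt-s≤g (ℚ.≤-refl {s})))) (0≤con (+ 7 ℚ./ 8)))
      (solve 3 (λ s u S → con 2ℚ :* (S :+ (:- s)) :+ (s :+ con (+ 1 ℚ./ 8) :+ (:- u)) :+ con (+ 7 ℚ./ 8)
        := (S :+ S :+ con 1ℚ) :+ (:- (s :+ u))) refl s (w ℚ.* t) S)

    -- With e = 2 - w², the product (s - w t)(s + w t) is 1 + e t² or -(1 - e t²) according to the
    -- norm; the smaller absolute value covers both.
    one≤ : (s ℚ.* s ≡ 1ℚ ℚ.+ (t ℚ.* t ℚ.+ t ℚ.* t)) ⊎ (1ℚ ℚ.+ s ℚ.* s ≡ t ℚ.* t ℚ.+ t ℚ.* t) →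
           1ℚ ℚ.- err w ℚ.* (t ℚ.* t) ℚ.≤ g ℚ.* (s ℚ.+ w ℚ.* t)
    one≤ (inj₁ eq) = ≤-by (+-0≤ (+-0≤ (+-0≤ (*-0≤ (0≤-diff x≤g) 0≤s+wt)
        (0≤-diff (ℚ.≤-reflexive (sym eq)))) (*-0≤ (0≤err i) (0≤sq t))) (*-0≤ (0≤err i) (0≤sq t)))
      (solve 4 (λ s t w g → let e = con 2ℚ :+ (:- (w :* w)) in
        (g :+ (:- (s :+ (:- (w :* t))))) :* (s :+ w :* t)
          :+ (s :* s :+ (:- (con 1ℚ :+ (t :* t :+ t :* t))))
          :+ e :* (t :* t) :+ e :* (t :* t)
        := g :* (s :+ w :* t) :+ (:- (con 1ℚ :+ (:- (e :* (t :* t)))))) refl s t w g)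
    one≤ (inj₂ eq) = ≤-by (+-0≤ (*-0≤ (0≤-diff -x≤g) 0≤s+wt)
        (0≤-diff (ℚ.≤-reflexive eq)))
      (solve 4 (λ s t w g → let e = con 2ℚ :+ (:- (w :* w)) in
        (g :+ (:- (:- (s :+ (:- (w :* t)))))) :* (s :+ w :* t)
          :+ (t :* t :+ t :* t :+ (:- (con 1ℚ :+ s :* s)))
        := g :* (s :+ w :* t) :+ (:- (con 1ℚ :+ (:- (e :* (t :* t)))))) refl s t w g)

triangle : ∀ p q P Q {c δ} → ℚ.∣ p ℚ.- P ∣ ℚ.≤ ½ ℚ.* δ → ℚ.∣ q ℚ.- Q ∣ ℚ.≤ ½ ℚ.* δ →
           ℚ.∣ q ℚ.* 1ℚ ℚ.- p ∣ ℚ.+ δ ℚ.≤ c → ℚ.∣ Q ℚ.- P ∣ ℚ.≤ c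
triangle p q P Q {c} {δ} hp hq h = begin
  ℚ.∣ Q ℚ.- P ∣
    ≡⟨ cong ℚ.∣_∣ (solve 4 (λ p q P Q → Q :+ (:- P)
         := (q :* con 1ℚ :+ (:- p)) :+ ((:- (q :+ (:- Q))) :+ (p :+ (:- P)))) refl p q P Q) ⟩
  ℚ.∣ v ℚ.+ (ℚ.- (q ℚ.- Q) ℚ.+ (p ℚ.- P)) ∣
    ≤⟨ ∣u+v∣≤ {v} ℚ.≤-refl (∣u+v∣≤ { ℚ.- (q ℚ.- Q)} {p ℚ.- P}
         (subst (ℚ._≤ ½ ℚ.* δ) (sym (ℚ.∣-p∣≡∣p∣ (q ℚ.- Q))) hq) hp) ⟩
  ℚ.∣ v ∣ ℚ.+ (½ ℚ.* δ ℚ.+ ½ ℚ.* δ)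
    ≡⟨ cong (ℚ.∣ v ∣ ℚ.+_) (half+half δ) ⟩
  ℚ.∣ v ∣ ℚ.+ δ
    ≤⟨ h ⟩
  c ∎
  where
  open ℚ.≤-Reasoning
  v = q ℚ.* 1ℚ ℚ.- p

-- ν + 1 is the (n + 1)-st s of norm ±1, so any such s below it is at most S.
module Gap
  (k : ℝ) {ε : ℚ} (0<ε : 0ℚ ℚ.< ε) (gap : Eventually λ i → seq k i ℚ.+ ε ℚ.≤ seq κ i)
  (n : ℕ) {ν : ℚ} (1+ν≡ : 1ℚ ℚ.+ ν ≡ fromNat (Pell.S (suc n)))
  (10≤ν : + 10 ℚ./ 1 ℚ.≤ ν) (3≤εn : + 3 ℚ./ 1 ℚ.≤ ε ℚ.* fromNat n)
  where

  S = fromNat (Pell.S n)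
  T = fromNat (Pell.T n)

  ν≡ : ν ≡ S ℚ.+ (T ℚ.+ T) ℚ.- 1ℚ
  ν≡ = trans (solve 1 (λ ν → ν := con 1ℚ :+ ν :+ (:- con 1ℚ)) refl ν)
    (cong (ℚ._- 1ℚ) (trans 1+ν≡ (trans (fromNat-+ (Pell.S n) (Pell.T n ℕ.+ Pell.T n))
      (cong (S ℚ.+_) (fromNat-+ (Pell.T n) (Pell.T n))))))

  3≤εS : + 3 ℚ./ 1 ℚ.≤ ε ℚ.* S
  3≤εS = ℚ.≤-trans 3≤εn (ℚ.*-monoˡ-≤-nonNeg ε {{ℚ.nonNegative (ℚ.<⇒≤ 0<ε)}} (fromNat-mono-≤ (Pell.n≤S n)))

  0<ν : 0ℚ ℚ.< ν
  0<ν = ℚ.<-≤-trans (0<con (+ 10 ℚ./ 1)) 10≤ν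

  0≤ν = ℚ.<⇒≤ 0<ν

  double-square : ∀ t → fromNat (t ℕ.* t ℕ.+ t ℕ.* t) ≡ fromNat t ℚ.* fromNat t ℚ.+ fromNat t ℚ.* fromNat t
  double-square t = trans (fromNat-+ (t ℕ.* t) (t ℕ.* t)) (cong₂ ℚ._+_ (fromNat-* t t) (fromNat-* t t))

  norm : ∀ s t → Pell.IsPell s t → let s' = fromNat s ; t' = fromNat t in
         (s' ℚ.* s' ≡ 1ℚ ℚ.+ (t' ℚ.* t' ℚ.+ t' ℚ.* t')) ⊎ (1ℚ ℚ.+ s' ℚ.* s' ≡ t' ℚ.* t' ℚ.+ t' ℚ.* t')
  norm s t (inj₁ eq) = inj₁ (trans (sym (fromNat-* s s)) (trans (cong fromNat eq) (cong (1ℚ ℚ.+_) (double-square t))))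
  norm s t (inj₂ eq) = inj₂ (trans (cong (1ℚ ℚ.+_) (sym (fromNat-* s s))) (trans (cong fromNat eq) (double-square t)))

  S²≤ : S ℚ.* S ℚ.≤ T ℚ.* T ℚ.+ T ℚ.* T ℚ.+ 1ℚ
  S²≤ with norm (Pell.S n) (Pell.T n) (Pell.pell n)
  ... | inj₁ eq = ℚ.≤-reflexive (trans eq (ℚ.+-comm 1ℚ (T ℚ.* T ℚ.+ T ℚ.* T)))
  ... | inj₂ eq = ≤-by (+-0≤ (0≤con 2ℚ) (0≤-diff (ℚ.≤-reflexive eq)))
    (solve 2 (λ x y → con 2ℚ :+ (y :+ (:- (con 1ℚ :+ x))) := y :+ con 1ℚ :+ (:- x)) refl (S ℚ.* S) (T ℚ.* T ℚ.+ T ℚ.* T))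

  -- The disjunction says which of s and √2 t is the denominator. Its bounds 1 ≤ q ≤ ν are relaxed
  -- by ½, twice the tolerance ¼ in `Observed`.
  Near : ℚ → ℚ → ℕ → Set
  Near s t i = ℚ.∣ s ℚ.- √2-approx i ℚ.* t ∣ ℚ.≤ seq k i ℚ.* recip ν ×
    ((½ ℚ.≤ s × s ℚ.≤ ν ℚ.+ ½) ⊎ (½ ℚ.≤ √2-approx i ℚ.* t × √2-approx i ℚ.* t ℚ.≤ ν ℚ.+ ½))

  -- As t is fixed, one index can be found where 2 - √2² is small even against ν t². There the
  -- estimates make (s , t) a Pell solution below the next one, and `refute` applies.
  none-near : ∀ {y t} → Integral y → Integral t → ¬ Eventually (Near (1ℚ ℚ.+ (y ℚ.+ y)) t)
  none-near {y} {t} iy it near = at (instant (near ⊗ gap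
    ⊗ err-scaled-small (0≤sq t) (0<con (+ 1 ℚ./ 16))
    ⊗ err-scaled-small (*-0≤ 0≤ν (0≤sq t)) 0<1))
    where
    at : ∃[ i ] (Near (1ℚ ℚ.+ (y ℚ.+ y)) t i × seq k i ℚ.+ ε ℚ.≤ seq κ i ×
                 err (√2-approx i) ℚ.* (t ℚ.* t) ℚ.≤ + 1 ℚ./ 16 ×
                 err (√2-approx i) ℚ.* (ν ℚ.* (t ℚ.* t)) ℚ.≤ 1ℚ) → ⊥
    at (i , (close , range) , k+ε≤κ , et²≤ , eνt²≤) = conclude
      (positive-odd iy A.0<s) (positive-integral it A.0<t)
      where
      module A = Approximation i {1ℚ ℚ.+ (y ℚ.+ y)} {t} {ν} {seq k i} {ε} 10≤ν 0<ε k+ε≤κ close range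

      conclude : ∃[ n ] (1ℚ ℚ.+ (y ℚ.+ y) ≡ fromNat (suc (n ℕ.+ n))) → ∃[ n ] (t ≡ fromNat n) → ⊥
      conclude (y' , s≡) (t' , t≡) = A.refute ν≡ (0≤fromNat (Pell.S n)) (0≤fromNat (Pell.T n)) S²≤
        (subst (ℚ._≤ S) (sym s≡) (fromNat-mono-≤ (Pell.s≤S {s'} {t'} n is-pell
          (fromNat-cancel-< (subst₂ ℚ._<_ s≡ 1+ν≡ A.s<1+ν)))))
        (subst₂ (λ s t → (s ℚ.* s ≡ 1ℚ ℚ.+ (t ℚ.* t ℚ.+ t ℚ.* t)) ⊎ (1ℚ ℚ.+ s ℚ.* s ≡ t ℚ.* t ℚ.+ t ℚ.* t))
          (sym s≡) (sym t≡) (norm s' t' is-pell))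
        3≤εS eνt²≤
        where
        s' = suc (y' ℕ.+ y')

        s²≡ = trans (fromNat-* s' s') (sym (cong (λ s → s ℚ.* s) s≡))
        2t²≡ = trans (double-square t') (sym (cong (λ t → t ℚ.* t ℚ.+ t ℚ.* t) t≡))

        is-pell : Pell.IsPell s' t'
        is-pell = Pell.odd-near y' t'
          (fromNat-cancel-< (subst₂ ℚ._<_ (sym s²≡)
            (sym (trans (fromNat-+ (t' ℕ.* t' ℕ.+ t' ℕ.* t') 3) (cong (ℚ._+ + 3 ℚ./ 1) 2t²≡))) A.s²<2t²+3))
          (fromNat-cancel-< (subst₂ ℚ._<_ (sym 2t²≡)
            (sym (trans (fromNat-+ (s' ℕ.* s') 3) (cong (ℚ._+ + 3 ℚ./ 1) s²≡))) (A.2t²<s²+3 et²≤)))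

  in-range : ∀ {q Q} → ℚ.∣ q ℚ.- Q ∣ ℚ.≤ + 1 ℚ./ 4 → 1ℚ ℚ.≤ q ℚ.+ + 1 ℚ./ 4 → q ℚ.≤ ν ℚ.+ + 1 ℚ./ 4 →
             ½ ℚ.≤ Q × Q ℚ.≤ ν ℚ.+ ½
  in-range {q} {Q} h 1≤q q≤ν =
    ≤-by (+-0≤ (0≤-diff (∣∣-upper {q} {Q} h)) (0≤-diff 1≤q))
      (solve 2 (λ q Q → (Q :+ con (+ 1 ℚ./ 4) :+ (:- q)) :+ (q :+ con (+ 1 ℚ./ 4) :+ (:- con 1ℚ)) := Q :+ (:- con ½)) refl q Q) ,
    ≤-by (+-0≤ (0≤-diff (∣∣-lower {q} {Q} h)) (0≤-diff q≤ν))
      (solve 3 (λ q Q ν → (q :+ (:- (Q :+ (:- con (+ 1 ℚ./ 4))))) :+ (ν :+ con (+ 1 ℚ./ 4) :+ (:- q)) := ν :+ con ½ :+ (:- Q)) refl q Q ν)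

  no-solution : ∀ p q (0<νℝ : 0ℝ < fromℚ ν) → Normalized p q →
                ∣ q * 1ℝ - p ∣ < k / fromℚ ν [ 0<νℝ ] → 1ℝ ≤ q → q ≤ fromℚ ν → ⊥
  no-solution p q 0<νℝ (normalized r s h _) = by-parity (parity h)
    where
    by-parity : Parity ⟦ p , r ⨾ q , s ⟧ → ∣ q * 1ℝ - p ∣ < k / fromℚ ν [ 0<νℝ ] →
                1ℝ ≤ q → q ≤ fromℚ ν → ⊥
    by-parity par (δ , 0<δ , value) 1≤q q≤ν = split par
      where
      ¼ = + 1 ℚ./ 4

      Observed : ℝ → ℝ → ℕ → Set
      Observed P Q i = ℚ.∣ seq p i ℚ.- seq P i ∣ ℚ.≤ ½ ℚ.* δ × ℚ.∣ seq q i ℚ.- seq Q i ∣ ℚ.≤ ½ ℚ.* δ ×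
        ℚ.∣ seq q i ℚ.* 1ℚ ℚ.- seq p i ∣ ℚ.+ δ ℚ.≤ seq k i ℚ.* recip ν ×
        ℚ.∣ seq q i ℚ.- seq Q i ∣ ℚ.≤ ¼ × 1ℚ ℚ.≤ seq q i ℚ.+ ¼ × seq q i ℚ.≤ ν ℚ.+ ¼

      observe : ∀ P Q → p ≃ P → q ≃ Q → Eventually (Observed P Q)
      observe P Q p≃ q≃ = p≃ (½ ℚ.* δ) (half-pos 0<δ) ⊗ q≃ (½ ℚ.* δ) (half-pos 0<δ) ⊗ value
        ⊗ q≃ ¼ (0<con ¼) ⊗ 1≤q ¼ (0<con ¼) ⊗ q≤ν ¼ (0<con ¼)

      even-near : ∀ y t i → Observed (oddℝ y) (√2 * fromℚ t) i → Near (1ℚ ℚ.+ (y ℚ.+ y)) t i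
      even-near y t i (a , b , c , d , e , f) =
        subst (ℚ._≤ seq k i ℚ.* recip ν) (∣p-q∣≡∣q-p∣ Q P) (triangle (seq p i) (seq q i) P Q a b c) ,
        inj₂ (in-range {seq q i} {Q} d e f)
        where
        P = 1ℚ ℚ.+ (y ℚ.+ y)
        Q = √2-approx i ℚ.* t

      odd-near : ∀ y t i → Observed (√2 * fromℚ t) (oddℝ y) i → Near (1ℚ ℚ.+ (y ℚ.+ y)) t i
      odd-near y t i (a , b , c , d , e , f) =
        triangle (seq p i) (seq q i) P Q a b c , inj₁ (in-range {seq q i} {Q} d e f)
        where
        P = √2-approx i ℚ.* t
        Q = 1ℚ ℚ.+ (y ℚ.+ y)

      split : Parity ⟦ p , r ⨾ q , s ⟧ → ⊥
      split (inj₁ ((y , iy , p≃) , _ , (t , it , q≃) , _)) =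
        none-near {y} {t} iy it (ev-map (even-near y t) (observe (oddℝ y) (√2 * fromℚ t) p≃ q≃))
      split (inj₂ ((t , it , p≃) , _ , (y , iy , q≃) , _)) =
        none-near {y} {t} iy it (ev-map (odd-near y t) (observe (√2 * fromℚ t) (oddℝ y) p≃ q≃))

K≥κ : ∀ k → Admissible 1ℝ k → ¬ (k < κ)
K≥κ k (_ , N₀ , solution) (ε , 0<ε , gap) =
  let B , 0<B , N₀-bound = bounded N₀
  in beyond B 0<B N₀-bound
  where
  0<3/ε = *-0< (0<con (+ 3 ℚ./ 1)) (recip-pos 0<ε)

  beyond : ∀ B → 0ℚ ℚ.< B → Eventually (λ i → ℚ.∣ seq N₀ i ∣ ℚ.≤ B) → ⊥
  beyond B 0<B N₀-bound =
    let p , q , norm , value , 1≤q , q≤ν = solution (fromℚ ν) N₀≤ν 0<νℝ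
    in Gap.no-solution k 0<ε gap n 1+ν≡ (ℚ.≤-trans 10≤n n≤ν) 3≤εn p q 0<νℝ norm value 1≤q q≤ν
    where
    10ℚ = + 10 ℚ./ 1
    3/ε = + 3 ℚ./ 1 ℚ.* recip ε
    -- The numerator of a rational bounds it, so n exceeds the bound B of `N₀`, the 10 of
    -- `Approximation`, and 3/ε.
    n = ℤ.∣ ℚ.numerator (B ℚ.+ 10ℚ ℚ.+ 3/ε) ∣
    ν = fromNat (Pell.S (suc n)) ℚ.- 1ℚ

    1+ν≡ : 1ℚ ℚ.+ ν ≡ fromNat (Pell.S (suc n))
    1+ν≡ = solve 1 (λ S → con 1ℚ :+ (S :+ (:- con 1ℚ)) := S) refl (fromNat (Pell.S (suc n)))

    n≤ν : fromNat n ℚ.≤ ν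
    n≤ν = ≤-by (0≤-diff (fromNat-mono-≤ (Pell.n≤S (suc n))))
      (solve 2 (λ n S → S :+ (:- (con 1ℚ :+ n)) := (S :+ (:- con 1ℚ)) :+ (:- n)) refl
        (fromNat n) (fromNat (Pell.S (suc n))))

    large : B ℚ.+ 10ℚ ℚ.+ 3/ε ℚ.≤ fromNat n
    large = ≤-fromNat (B ℚ.+ 10ℚ ℚ.+ 3/ε)

    B≤n : B ℚ.≤ fromNat n
    B≤n = ℚ.≤-trans (≤-by (+-0≤ (0≤con 10ℚ) (ℚ.<⇒≤ 0<3/ε))
      (solve 3 (λ b c d → c :+ d := b :+ c :+ d :+ (:- b)) refl B 10ℚ 3/ε)) large

    10≤n : 10ℚ ℚ.≤ fromNat n
    10≤n = ℚ.≤-trans (≤-by (+-0≤ (ℚ.<⇒≤ 0<B) (ℚ.<⇒≤ 0<3/ε))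
      (solve 3 (λ b c d → b :+ d := b :+ c :+ d :+ (:- c)) refl B 10ℚ 3/ε)) large

    3/ε≤n : 3/ε ℚ.≤ fromNat n
    3/ε≤n = ℚ.≤-trans (≤-by (+-0≤ (ℚ.<⇒≤ 0<B) (0≤con 10ℚ))
      (solve 3 (λ b c d → b :+ c := b :+ c :+ d :+ (:- d)) refl B 10ℚ 3/ε)) large

    3≤εn : + 3 ℚ./ 1 ℚ.≤ ε ℚ.* fromNat n
    3≤εn = ≤-by (*-0≤ (ℚ.<⇒≤ 0<ε) (0≤-diff 3/ε≤n))
      (trans (solve 3 (λ e r n → e :* (n :+ (:- (con (+ 3 ℚ./ 1) :* r)))
          := e :* n :+ (:- (con (+ 3 ℚ./ 1) :* (e :* r)))) refl ε (recip ε) (fromNat n))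
        (cong (λ t → ε ℚ.* fromNat n ℚ.- + 3 ℚ./ 1 ℚ.* t) (recip-inverse 0<ε)))

    0<νℝ : 0ℝ < fromℚ ν
    0<νℝ = ν , ℚ.<-≤-trans (0<con 10ℚ) (ℚ.≤-trans 10≤n n≤ν) , 0 , λ _ _ → ℚ.≤-reflexive (ℚ.+-identityˡ ν)

    N₀≤ν : N₀ ≤ fromℚ ν
    N₀≤ν δ 0<δ = ev-map
      (λ i N₀≤B → subst (ℚ._≤ ν ℚ.+ δ) (ℚ.+-identityʳ (seq N₀ i))
        (ℚ.+-mono-≤ (ℚ.≤-trans (p≤∣p∣ (seq N₀ i)) (ℚ.≤-trans N₀≤B (ℚ.≤-trans B≤n n≤ν))) (ℚ.<⇒≤ 0<δ)))
      N₀-bound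

-- From refuting k < κ to the infimum.

-- A rational sample of z, accurate to ε/4, is compared with r - ε/2; either outcome leaves a margin
-- of ε/4.
<-cotrans : ∀ {x z} r → x < fromℚ r → x < z ⊎ z < fromℚ r
<-cotrans {x} {z} r (ε , 0<ε , N , h) = decide (ℚ.≤-total (seq z m) (r ℚ.- ½ ℚ.* ε))
  where
  δ = ½ ℚ.* (½ ℚ.* ε)
  0<δ = half-pos (half-pos 0<ε)
  m = proj₁ (cauchy z δ 0<δ)

  close : Eventually λ n → ℚ.∣ seq z n ℚ.- seq z m ∣ ℚ.≤ δ
  close = m , λ n m≤n → proj₂ (cauchy z δ 0<δ) n m m≤n ℕ.≤-refl

  decide : _ ⊎ _ → x < z ⊎ z < fromℚ r
  decide (inj₁ z≤) = inj₂ (δ , 0<δ , ev-map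
    (λ n c → ≤-by (+-0≤ (0≤-diff z≤) (0≤-diff (∣∣-upper {seq z n} {seq z m} c)))
      (solve 4 (λ zm zn r ε → (r :+ (:- (con ½ :* ε)) :+ (:- zm)) :+ (zm :+ con ½ :* (con ½ :* ε) :+ (:- zn))
        := r :+ (:- (zn :+ con ½ :* (con ½ :* ε)))) refl (seq z m) (seq z n) r ε)) close)
  decide (inj₂ ≤z) = inj₁ (δ , 0<δ , ev-map
    (λ n (c , xn) → ≤-by (+-0≤ (+-0≤ (0≤-diff ≤z) (0≤-diff (∣∣-lower {seq z n} {seq z m} c))) (0≤-diff xn))
      (solve 5 (λ zm zn xn r ε → (zm :+ (:- (r :+ (:- (con ½ :* ε))))) :+ (zn :+ (:- (zm :+ (:- (con ½ :* (con ½ :* ε))))))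
          :+ (r :+ (:- (xn :+ ε)))
        := zn :+ (:- (xn :+ con ½ :* (con ½ :* ε)))) refl (seq z m) (seq z n) (seq x n) r ε)) (close ⊗ (N , h)))

-- `K≥κ` only refutes k < κ. Cotransitivity applied to k < r turns this into the positive statement
-- κ < r.
lower : fromℝ κ ≤ᵁ K 1ℝ
lower r (k , adm , k<r) with <-cotrans {k} {κ} r k<r
... | inj₁ k<κ = ⊥-elim (K≥κ k adm k<κ)
... | inj₂ κ<r = κ<r

mainTheorem2 : (∀ (α : ℝ) → ¬ (α ∈ℚ[H₄]) → K α ≤ᵁ K 1ℝ) ×
    K 1ℝ ≃ᵁ fromℝ ((√2 + 1ℝ) / 2ℝ [ 0<2 ])
mainTheorem2 = (λ α _ r 1<r → upper α r (lower r 1<r)) , upper 1ℝ , lower
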